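{- Let $n\geq 3$ and $1\leq i<j\leq n$ be integers, and let $t_{1},\ldots,t_{n}$ be independent indeterminates (rational parameters). Then the system of equations \[ \sigma_{i}(x_{1},\ldots,x_{n})=\sigma_{i}(t_{1},\ldots,t_{n}),\qquad \sigma_{j}(x_{1},\ldots,x_{n})=\sigma_{j}(t_{1},\ldots,t_{n}) \] has infinitely many solutions $(x_1,\ldots,x_n)$ with $x_{1},\ldots,x_n\in\mathbb{Q}(t_{1},\ldots,t_{n})$.
   Context: For $1\leq i\leq n$, $\sigma_{i}(x_{1},\ldots,x_{n})=\sum_{1\leq k_{1}<\cdots<k_{i}\leq n}x_{k_{1}}\cdots x_{k_{i}}$ denotes the $i$-th elementary symmetric polynomial. -}

module Defs where

open import Data.Nat using (ℕ; zero; suc)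
open import Data.Fin using (Fin)
open import Data.Rational using (ℚ; 0ℚ; 1ℚ) renaming (_+_ to _+ℚ_; _*_ to _*ℚ_; -_ to -ℚ_)
open import Data.List using (List; []; _∷_; tabulate)
open import Data.Product using (_×_)
open import Relation.Binary.PropositionalEquality using (_≡_)
open import Relation.Nullary using (¬_)

data Poly (n : ℕ) : Set where
  con  : ℚ → Poly n
  var  : Fin n → Poly n
  _⊕_  : Poly n → Poly n → Poly n
  _⊗_  : Poly n → Poly n → Poly n
  ⊖_   : Poly n → Poly n

eval : ∀ {n} → Poly n → (Fin n → ℚ) → ℚ
eval (con c) ρ = c
eval (var k) ρ = ρ k
eval (p ⊕ q) ρ = eval p ρ +ℚ eval q ρ
eval (p ⊗ q) ρ = eval p ρ *ℚ eval q ρ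
eval (⊖ p)   ρ = -ℚ eval p ρ

-- Equality in ℚ[t₁,…,tₙ]; since ℚ is infinite, two polynomials are equal
-- iff they agree at every point of ℚⁿ.
_≈P_ : ∀ {n} → Poly n → Poly n → Set
p ≈P q = ∀ ρ → eval p ρ ≡ eval q ρ

NonZeroPoly : ∀ {n} → Poly n → Set
NonZeroPoly p = ¬ (p ≈P con 0ℚ)

record RatFun (n : ℕ) : Set where
  constructor _//_
  field
    num : Poly n
    den : Poly n
open RatFun public

ValidRF : ∀ {n} → RatFun n → Set
ValidRF f = NonZeroPoly (den f)

_≈R_ : ∀ {n} → RatFun n → RatFun n → Set
f ≈R g = (num f ⊗ den g) ≈P (num g ⊗ den f)

0R 1R : ∀ {n} → RatFun n
0R = con 0ℚ // con 1ℚ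
1R = con 1ℚ // con 1ℚ

_+R_ _*R_ : ∀ {n} → RatFun n → RatFun n → RatFun n
(a // b) +R (c // d) = ((a ⊗ d) ⊕ (c ⊗ b)) // (b ⊗ d)
(a // b) *R (c // d) = (a ⊗ c) // (b ⊗ d)

σL : ∀ {n} → ℕ → List (RatFun n) → RatFun n
σL zero    _        = 1R
σL (suc k) []       = 0R
σL (suc k) (x ∷ xs) = σL (suc k) xs +R (x *R σL k xs)

σ : ∀ {n m} → ℕ → (Fin m → RatFun n) → RatFun n
σ k x = σL k (tabulate x)

t : ∀ {n} → Fin n → RatFun n
t k = var k // con 1ℚ

IsSolution : (n i j : ℕ) → (Fin n → RatFun n) → Set
IsSolution n i j x =
  (∀ k → ValidRF (x k)) × (σ i x ≈R σ i t) × (σ j x ≈R σ j t)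

_≈V_ : ∀ {n} → (Fin n → RatFun n) → (Fin n → RatFun n) → Set
x ≈V y = ∀ k → x k ≈R y k

{-# OPTIONS --safe #-}
module Submission where

-- Only x₁, x₂, x₃ are varied. The two equations are linear in their elementary symmetric functions,
-- so if the cubic h has a solution as its roots, the other solutions are the split members of a
-- pencil h + λ g; together with an ordering of the roots they form a curve of genus one in general.
-- Given a solution (x, y, z), let M be the Möbius map x ↦ y ↦ z ↦ x. The equation
-- h(X) g(MX) = h(MX) g(X), once divided by the quadratic form of the fixed points of M and by h,
-- is linear in X: its root X and MX are two of the roots of another member of the pencil, so the
-- third is rational as well. Iterating this step from (t₁, t₂, t₃) gives the solutions.
-- That they are defined and distinct is checked at one rational point t, at which h and g
-- share a root; there the curve breaks up into lines and the step becomes W ↦ W³.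
-- For i = 1, j = 2 the pencil direction g is constant and the curve is a conic, which is parametrised.

open import Defs
open import Algebra.Bundles using (CommutativeRing)
open import Algebra.Structures using (IsCommutativeRing)
import Algebra.Solver.Ring
import Algebra.Solver.Ring.AlmostCommutativeRing as ACR
open import Data.Fin using (Fin; zero; suc)
open import Data.Integer as ℤ using (ℤ) renaming (+_ to pos)
import Data.Integer.Properties as ℤ
open import Data.List as List using (List; []; _∷_; length)
import Data.Maybe as Maybe
open import Data.Nat as ℕ using (ℕ; zero; suc; _≤_; _<_; _⊔_; z≤n; s≤s)
open import Data.Nat.Combinatorics using (nCn≡1; nCk≡nC[n∸k]; k>n⇒nCk≡0; nCk+nC[k+1]≡[n+1]C[k+1])
  renaming (_C_ to _choose_)
import Data.Nat.Coprimality as Coprime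
import Data.Nat.Properties as ℕ
open import Data.Product using (Σ; ∃-syntax; _×_; _,_; proj₁; proj₂)
open import Data.Rational as ℚ using (ℚ; mkℚ; 0ℚ; 1ℚ)
import Data.Rational.Properties as ℚ
open import Data.Rational.Unnormalised using (*≡*)
import Data.Rational.Unnormalised.Properties as ℚᵘ
open import Data.Sum using (inj₁; inj₂; [_,_]′)
open import Function using (_∘_)
open import Level using (0ℓ)
open import Relation.Binary.Definitions using (tri<; tri≈; tri>)
open import Relation.Binary.PropositionalEquality
open import Relation.Nullary using (¬_; yes; no; contradiction)
open import Relation.Nullary.Decidable using (dec⇒maybe; decidable-stable)
open ≡-Reasoning

-- Arithmetic of ℚ

infixl 6 _+_
infixl 7 _*_
infix 8 -_

-- Built by the constructor, not as a quotient, so that injectivity and facts such as `D≢0` follow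
-- by pattern matching.
fromℤ : ℤ → ℚ
fromℤ i = mkℚ i 0 (Coprime.sym (Coprime.1-coprimeTo _))

fromℕ : ℕ → ℚ
fromℕ n = fromℤ (pos n)

-- Opaque copies of the operations: unfolding those of ℚ on open terms makes the ring solver unusable.
abstract
  _+_ _*_ : ℚ → ℚ → ℚ
  _+_ = ℚ._+_
  _*_ = ℚ._*_

  -_ inv : ℚ → ℚ
  -_ = ℚ.-_
  inv x with x ℚ.≟ 0ℚ
  ... | yes _   = 0ℚ
  ... | no  x≢0 = (ℚ.1/ x) {{ℚ.≢-nonZero x≢0}}

  +-def : ∀ x y → x ℚ.+ y ≡ x + y
  +-def _ _ = refl

  *-def : ∀ x y → x ℚ.* y ≡ x * y
  *-def _ _ = refl

  neg-def : ∀ x → ℚ.- x ≡ - x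
  neg-def _ = refl

  *-inv : ∀ {x} → x ≢ 0ℚ → x * inv x ≡ 1ℚ
  *-inv {x} x≢0 with x ℚ.≟ 0ℚ
  ... | yes x≡0 = contradiction x≡0 x≢0
  ... | no  x≢0 = ℚ.*-inverseʳ x {{ℚ.≢-nonZero x≢0}}

  isCommutativeRing : IsCommutativeRing _≡_ _+_ _*_ -_ 0ℚ 1ℚ
  isCommutativeRing = ℚ.+-*-isCommutativeRing

  fromℤ-+ : ∀ i j → fromℤ (i ℤ.+ j) ≡ fromℤ i + fromℤ j
  fromℤ-+ i j = ℚ.toℚᵘ-injective (ℚᵘ.≃-trans
    (*≡* (cong (ℤ._* pos 1) (cong₂ ℤ._+_ (sym (ℤ.*-identityʳ i)) (sym (ℤ.*-identityʳ j)))))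
    (ℚᵘ.≃-sym (ℚ.toℚᵘ-homo-+ (fromℤ i) (fromℤ j))))

  fromℤ-* : ∀ i j → fromℤ (i ℤ.* j) ≡ fromℤ i * fromℤ j
  fromℤ-* i j = ℚ.toℚᵘ-injective (ℚᵘ.≃-sym (ℚ.toℚᵘ-homo-* (fromℤ i) (fromℤ j)))

  fromℤ-neg : ∀ i → fromℤ (ℤ.- i) ≡ - fromℤ i
  fromℤ-neg (pos zero)    = refl
  fromℤ-neg (pos (suc _)) = refl
  fromℤ-neg ℤ.-[1+ _ ]    = refl

commutativeRing : CommutativeRing 0ℓ 0ℓ
commutativeRing = record { isCommutativeRing = isCommutativeRing }

open CommutativeRing commutativeRing
  using (*-comm; *-assoc; *-identityˡ; *-identityʳ; zeroˡ; zeroʳ)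

private
  morphism : ℤ.+-*-rawRing ACR.-Raw-AlmostCommutative⟶ ACR.fromCommutativeRing commutativeRing
  morphism = record
    { ⟦_⟧ = fromℤ ; +-homo = fromℤ-+ ; *-homo = fromℤ-* ; -‿homo = fromℤ-neg
    ; 0-homo = refl ; 1-homo = refl }

module Solver = Algebra.Solver.Ring ℤ.+-*-rawRing (ACR.fromCommutativeRing commutativeRing) morphism
  (λ i j → Maybe.map (cong fromℤ) (dec⇒maybe (i ℤ.≟ j)))
open Solver using (solve; _:=_; _:+_; _:*_; _:-_; :-_; con)

fromℕ-+ : ∀ m n → fromℕ (m ℕ.+ n) ≡ fromℕ m + fromℕ n
fromℕ-+ m n = fromℤ-+ (pos m) (pos n)

fromℕ-* : ∀ m n → fromℕ (m ℕ.* n) ≡ fromℕ m * fromℕ n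
fromℕ-* m n = trans (cong fromℤ (ℤ.pos-* m n)) (fromℤ-* (pos m) (pos n))

fromℕ-injective : ∀ {m n} → fromℕ m ≡ fromℕ n → m ≡ n
fromℕ-injective refl = refl

x*y≡0⇒y≡0 : ∀ {x y} → x ≢ 0ℚ → x * y ≡ 0ℚ → y ≡ 0ℚ
x*y≡0⇒y≡0 {x} {y} x≢0 xy≡0 = begin
  y               ≡⟨ *-identityʳ y ⟨
  y * 1ℚ          ≡⟨ cong (y *_) (*-inv x≢0) ⟨
  y * (x * inv x) ≡⟨ solve 3 (λ x y i → y :* (x :* i) := x :* y :* i) refl x y (inv x) ⟩
  x * y * inv x   ≡⟨ cong (_* inv x) xy≡0 ⟩
  0ℚ * inv x      ≡⟨ zeroˡ _ ⟩
  0ℚ              ∎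

-- The step along the curve

-- The same formulas are evaluated in ℚ, in RatFun, on pairs of a rational function with its value
-- at a point, and on the polynomials of the ring solver.
record Operations (A : Set) : Set where
  constructor operations
  infixl 6 _⊞_ _⊟_
  infixl 7 _⊠_
  field
    _⊞_ _⊠_ : A → A → A
    neg inverse : A → A

  _⊟_ : A → A → A
  x ⊟ y = x ⊞ neg y

module Formulas {A : Set} (O : Operations A) where
  open Operations O

  -- X ↦ (aX + b) / (cX + d) is the Möbius map x ↦ y ↦ z ↦ x.
  module Möbius (x y z : A) where
    c d a b : A
    c = (x ⊟ y) ⊠ (x ⊟ y) ⊟ (y ⊟ z) ⊠ (z ⊟ x)
    d = neg (c ⊠ x) ⊟ (y ⊟ x) ⊠ ((z ⊟ x) ⊠ (z ⊟ x))
    a = y ⊠ c ⊟ (y ⊟ x) ⊠ ((y ⊟ z) ⊠ (y ⊟ z))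
    b = y ⊠ d ⊞ x ⊠ ((y ⊟ x) ⊠ ((y ⊟ z) ⊠ (y ⊟ z)))

  -- (d₁, d₂, d₃) is the direction in which the elementary symmetric functions of x, y, z may move,
  -- and ℓ₁ X = ℓ₀ the linear equation for x′.
  module Step (d₁ d₂ d₃ x y z : A) where
    open Möbius x y z public

    ℓ₁ ℓ₀ x′ y′ slope z′ : A
    ℓ₁ = d₁ ⊠ (a ⊠ a) ⊟ d₂ ⊠ (a ⊠ c) ⊞ d₃ ⊠ (c ⊠ c)
    ℓ₀ = d₁ ⊠ (b ⊠ d) ⊟ d₂ ⊠ (d ⊠ d) ⊟ d₃ ⊠ (c ⊠ (d ⊞ d ⊞ a))
    x′ = ℓ₀ ⊠ inverse ℓ₁
    y′ = (a ⊠ x′ ⊞ b) ⊠ inverse (c ⊠ x′ ⊞ d)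

    -- The roots of `h + s g` have elementary symmetric functions `eᵢ + s dᵢ`, where the `eᵢ` are
    -- those of `x`, `y`, `z`.
    h g : A → A
    h t = (t ⊟ x) ⊠ (t ⊟ y) ⊠ (t ⊟ z)
    g t = d₂ ⊠ t ⊟ d₁ ⊠ (t ⊠ t) ⊟ d₃

    slope = neg (h x′) ⊠ inverse (g x′)
    z′ = x ⊞ y ⊞ z ⊞ slope ⊠ d₁ ⊟ x′ ⊟ y′

ℚ-operations : Operations ℚ
ℚ-operations = operations _+_ _*_ -_ inv

infixl 6 _-_
_-_ : ℚ → ℚ → ℚ
x - y = x + - y

-- The ring solver has no inverse, so the identity stands in for it; only division-free formulas are
-- taken from this instance.
module SolverFormulas {n} = Formulas {Solver.Polynomial n} (operations _:+_ _:*_ (λ p → :- p) (λ p → p))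
open Formulas ℚ-operations

module MöbiusProperties (x y z : ℚ) where
  open Möbius x y z

  -- The square of the trace equals the determinant; by Cayley-Hamilton this makes the cube of the
  -- matrix of M scalar, as it must be for a map that permutes three points cyclically.
  order-three : a * a + a * d + d * d + b * c ≡ 0ℚ
  order-three = solve 3 (λ x y z → let module M = SolverFormulas.Möbius x y z in
    M.a :* M.a :+ M.a :* M.d :+ M.d :* M.d :+ M.b :* M.c := con (pos 0)) refl x y z

  x↦y : ∀ X → a * X + b - y * (c * X + d) ≡ (a - y * c) * (X - x)
  x↦y = solve 4 (λ x y z X → let module M = SolverFormulas.Möbius x y z in
    M.a :* X :+ M.b :- y :* (M.c :* X :+ M.d) := (M.a :- y :* M.c) :* (X :- x)) refl x y z

  y↦z : ∀ X → a * X + b - z * (c * X + d) ≡ (a - z * c) * (X - y)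
  y↦z = solve 4 (λ x y z X → let module M = SolverFormulas.Möbius x y z in
    M.a :* X :+ M.b :- z :* (M.c :* X :+ M.d) := (M.a :- z :* M.c) :* (X :- y)) refl x y z

  z↦x : ∀ X → a * X + b - x * (c * X + d) ≡ (a - x * c) * (X - z)
  z↦x = solve 4 (λ x y z X → let module M = SolverFormulas.Möbius x y z in
    M.a :* X :+ M.b :- x :* (M.c :* X :+ M.d) := (M.a :- x :* M.c) :* (X :- z)) refl x y z

  -- The left side is the factor by which the matrix of M multiplies the cubic form with roots `x`,
  -- `y`, `z`. The cube of that matrix is the scalar `- (a + d)³`, so the two sides have equal
  -- cubes.
  leading : (a - x * c) * (a - y * c) * (a - z * c) ≡ - ((a + d) * (a + d) * (a + d))
  leading = solve 3 (λ x y z → let module M = SolverFormulas.Möbius x y z in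
    (M.a :- x :* M.c) :* (M.a :- y :* M.c) :* (M.a :- z :* M.c)
      := :- ((M.a :+ M.d) :* (M.a :+ M.d) :* (M.a :+ M.d))) refl x y z

𝟘 𝟙 : ∀ {n} → Solver.Polynomial n
𝟘 = con (pos 0)
𝟙 = con (pos 1)

-0≡0 : - 0ℚ ≡ 0ℚ
-0≡0 = solve 0 (:- 𝟘 := 𝟘) refl

x-y≡0⇒x≡y : ∀ {x y} → x - y ≡ 0ℚ → x ≡ y
x-y≡0⇒x≡y {x} {y} eq = begin
  x         ≡⟨ solve 2 (λ x y → x := x :- y :+ y) refl x y ⟩
  x - y + y ≡⟨ cong (_+ y) eq ⟩
  0ℚ + y    ≡⟨ solve 1 (λ y → 𝟘 :+ y := y) refl y ⟩
  y         ∎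

x≡y⇒x-y≡0 : ∀ {x y} → x ≡ y → x - y ≡ 0ℚ
x≡y⇒x-y≡0 {x} refl = solve 1 (λ x → x :- x := 𝟘) refl x

*-cancelˡ : ∀ {w x y} → w ≢ 0ℚ → w * x ≡ w * y → x ≡ y
*-cancelˡ {w} {x} {y} w≢0 eq = x-y≡0⇒x≡y (x*y≡0⇒y≡0 w≢0 (begin
  w * (x - y)   ≡⟨ solve 3 (λ w x y → w :* (x :- y) := w :* x :- w :* y) refl w x y ⟩
  w * x - w * y ≡⟨ x≡y⇒x-y≡0 eq ⟩
  0ℚ            ∎))

*-≢0 : ∀ {x y} → x ≢ 0ℚ → y ≢ 0ℚ → x * y ≢ 0ℚ
*-≢0 x≢0 y≢0 eq = y≢0 (x*y≡0⇒y≡0 x≢0 eq)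

x*[y*inv-x]≡y : ∀ {x} y → x ≢ 0ℚ → x * (y * inv x) ≡ y
x*[y*inv-x]≡y {x} y x≢0 = begin
  x * (y * inv x) ≡⟨ solve 3 (λ x y i → x :* (y :* i) := y :* (x :* i)) refl x y (inv x) ⟩
  y * (x * inv x) ≡⟨ cong (y *_) (*-inv x≢0) ⟩
  y * 1ℚ          ≡⟨ *-identityʳ y ⟩
  y               ∎

x*z≡y⇒y*inv-x≡z : ∀ {x y z} → x ≢ 0ℚ → x * z ≡ y → y * inv x ≡ z
x*z≡y⇒y*inv-x≡z {y = y} x≢0 eq = *-cancelˡ x≢0 (trans (x*[y*inv-x]≡y y x≢0) (sym eq))

module StepProperties (d₁ d₂ d₃ x y z : ℚ) where
  open Step d₁ d₂ d₃ x y z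
  open MöbiusProperties x y z

  -- The first three conditions are on the denominators of `x′`, `y′` and `slope`; the last allows
  -- division by the difference of the two new roots in `step-e₂`.
  record Regular : Set where
    constructor regular
    field
      ℓ₁≢0    : ℓ₁ ≢ 0ℚ
      pole≢x′ : c * x′ + d ≢ 0ℚ
      g≢0     : g x′ ≢ 0ℚ
      x′≢y′   : x′ - y′ ≢ 0ℚ

  module _ (X Y : ℚ) (image : (c * X + d) * Y ≡ a * X + b) where
    N = c * X + d

    private
      move : ∀ {m w v} → a * X + b - w * N ≡ m * v → (Y - w) * N ≡ m * v
      move {w = w} eq = begin
        (Y - w) * N       ≡⟨ solve 3 (λ Y w n → (Y :- w) :* n := n :* Y :- w :* n) refl Y w N ⟩
        N * Y - w * N     ≡⟨ cong (_- w * N) image ⟩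
        a * X + b - w * N ≡⟨ eq ⟩
        _                 ∎

    -- M permutes the roots of `h`, so `h` after M is a multiple of `h` once `N³` is cleared.
    h-image : N * N * N * h Y ≡ - ((a + d) * (a + d) * (a + d)) * h X
    h-image = begin
      N * N * N * h Y
        ≡⟨ solve 5 (λ x y z Y N → N :* N :* N :* ((Y :- x) :* (Y :- y) :* (Y :- z)) :=
             ((Y :- x) :* N) :* ((Y :- y) :* N) :* ((Y :- z) :* N)) refl x y z Y N ⟩
      ((Y - x) * N) * ((Y - y) * N) * ((Y - z) * N)
        ≡⟨ cong₂ _*_ (cong₂ _*_ (move (z↦x X)) (move (x↦y X))) (move (y↦z X)) ⟩
      ((a - x * c) * (X - z)) * ((a - y * c) * (X - x)) * ((a - z * c) * (X - y))
        ≡⟨ solve 7 (λ x y z X a b c → (a :* (X :- z)) :* (b :* (X :- x)) :* (c :* (X :- y)) :=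
             (a :* b :* c) :* ((X :- x) :* (X :- y) :* (X :- z))) refl x y z X _ _ _ ⟩
      (a - x * c) * (a - y * c) * (a - z * c) * h X
        ≡⟨ cong (_* h X) leading ⟩
      - ((a + d) * (a + d) * (a + d)) * h X ∎

    g-image : N * N * g Y ≡ d₂ * (N * (a * X + b)) - d₁ * ((a * X + b) * (a * X + b)) - d₃ * (N * N)
    g-image = begin
      N * N * g Y
        ≡⟨ solve 5 (λ d₁ d₂ d₃ N Y → N :* N :* (d₂ :* Y :- d₁ :* (Y :* Y) :- d₃) :=
             d₂ :* (N :* (N :* Y)) :- d₁ :* ((N :* Y) :* (N :* Y)) :- d₃ :* (N :* N)) refl d₁ d₂ d₃ N Y ⟩
      d₂ * (N * (N * Y)) - d₁ * ((N * Y) * (N * Y)) - d₃ * (N * N)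
        ≡⟨ cong (λ P → d₂ * (N * P) - d₁ * (P * P) - d₃ * (N * N)) image ⟩
      _ ∎

    -- X = MX is an obvious solution of h(X) g(MX) = h(MX) g(X), so the quadratic form of the
    -- fixed points of M splits off; the remaining factor is linear in X.
    same-fibre : N ≢ 0ℚ → ℓ₁ * X ≡ ℓ₀ → h Y * g X ≡ h X * g Y
    same-fibre N≢0 X-root = *-cancelˡ (*-≢0 (*-≢0 N≢0 N≢0) N≢0) (x-y≡0⇒x≡y (begin
      N * N * N * (h Y * g X) - N * N * N * (h X * g Y)
        ≡⟨ solve 5 (λ N hY gX hX gY → N :* N :* N :* (hY :* gX) :- N :* N :* N :* (hX :* gY) :=
             N :* N :* N :* hY :* gX :- hX :* (N :* (N :* N :* gY))) refl N (h Y) (g X) (h X) (g Y) ⟩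
      N * N * N * h Y * g X - h X * (N * (N * N * g Y))
        ≡⟨ cong₂ (λ u v → u * g X - h X * (N * v)) h-image g-image ⟩
      - κ * h X * g X - h X * (N * (d₂ * (N * (a * X + b)) - d₁ * ((a * X + b) * (a * X + b)) - d₃ * (N * N)))
        -- Here `a`, `b`, `c`, `d` are free variables, so the factorisation holds only modulo the
        -- relation `order-three`; `cofactor` is the multiplier of that relation.
        ≡⟨ solve 9 (λ d₁ d₂ d₃ a b c d X hX →
             let N = c :* X :+ d ; P = a :* X :+ b
                 ℓ₁ = d₁ :* (a :* a) :- d₂ :* (a :* c) :+ d₃ :* (c :* c)
                 ℓ₀ = d₁ :* (b :* d) :- d₂ :* (d :* d) :- d₃ :* (c :* (d :+ d :+ a)) in
             :- ((a :+ d) :* (a :+ d) :* (a :+ d)) :* hX :* (d₂ :* X :- d₁ :* (X :* X) :- d₃)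
               :- hX :* (N :* (d₂ :* (N :* P) :- d₁ :* (P :* P) :- d₃ :* (N :* N))) :=
             hX :* ((c :* (X :* X) :+ (d :- a) :* X :- b) :* (ℓ₁ :* X :- ℓ₀)
               :- (d₂ :* (c :* (X :* X) :+ (d :+ d :+ a) :* X)
                   :- d₁ :* ((a :+ a :+ d) :* (X :* X) :+ b :* X)
                   :- d₃ :* (c :* X :+ d :+ d :+ a))
                  :* (a :* a :+ a :* d :+ d :* d :+ b :* c)))
             refl d₁ d₂ d₃ a b c d X (h X) ⟩
      h X * (fix * (ℓ₁ * X - ℓ₀) - cofactor * (a * a + a * d + d * d + b * c))
        ≡⟨ cong₂ (λ u v → h X * (fix * u - cofactor * v)) (x≡y⇒x-y≡0 X-root) order-three ⟩
      h X * (fix * 0ℚ - cofactor * 0ℚ)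
        ≡⟨ solve 3 (λ h f c → h :* (f :* 𝟘 :- c :* 𝟘) := 𝟘) refl (h X) fix cofactor ⟩
      0ℚ ∎))
      where
      κ = (a + d) * (a + d) * (a + d)
      fix = c * (X * X) + (d - a) * X - b
      cofactor = d₂ * (c * (X * X) + (d + d + a) * X) - d₁ * ((a + a + d) * (X * X) + b * X)
        - d₃ * (c * X + d + d + a)

  e₁ e₂ e₃ : ℚ → ℚ → ℚ → ℚ
  e₁ x y z = x + y + z
  e₂ x y z = x * y + x * z + y * z
  e₃ x y z = x * y * z

  module _ (ok : Regular) where
    open Regular ok

    private
      -- The member of the pencil that has `x′` as a root; `slope` is chosen for this.
      H : ℚ → ℚ
      H t = h t + slope * g t

      Hx′≡0 : H x′ ≡ 0ℚ
      Hx′≡0 = begin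
        h x′ + slope * g x′   ≡⟨ cong (h x′ +_) (*-comm slope (g x′)) ⟩
        h x′ + g x′ * slope   ≡⟨ cong (h x′ +_) (x*[y*inv-x]≡y (- h x′) g≢0) ⟩
        h x′ - h x′           ≡⟨ x≡y⇒x-y≡0 refl ⟩
        0ℚ                    ∎

      -- By `same-fibre` the quotient of `h` by `g` agrees at `x′` and `y′`, so both lie on the same
      -- member of the pencil.
      Hy′≡0 : H y′ ≡ 0ℚ
      Hy′≡0 = x*y≡0⇒y≡0 g≢0 (begin
        g x′ * (h y′ + slope * g y′)
          ≡⟨ solve 5 (λ gx hx gy hy s → gx :* (hy :+ s :* gy) := hy :* gx :- hx :* gy :+ (hx :+ s :* gx) :* gy)
               refl (g x′) (h x′) (g y′) (h y′) slope ⟩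
        h y′ * g x′ - h x′ * g y′ + H x′ * g y′
          ≡⟨ cong₂ (λ u v → u + v * g y′)
               (x≡y⇒x-y≡0 (same-fibre x′ y′ (x*[y*inv-x]≡y _ pole≢x′) pole≢x′ (x*[y*inv-x]≡y _ ℓ₁≢0))) Hx′≡0 ⟩
        0ℚ + 0ℚ * g y′ ≡⟨ solve 1 (λ g → 𝟘 :+ 𝟘 :* g := 𝟘) refl (g y′) ⟩
        0ℚ ∎)

    step-e₁ : e₁ x′ y′ z′ ≡ e₁ x y z + slope * d₁
    step-e₁ = solve 7 (λ x y z X Y s d → X :+ Y :+ (x :+ y :+ z :+ s :* d :- X :- Y) := x :+ y :+ z :+ s :* d)
      refl x y z x′ y′ slope d₁

    -- `z′` is defined so that the sum of the roots is right; dividing `H x′ - H y′` by `x′ - y′`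
    -- then leaves exactly the comparison of the second coefficients.
    step-e₂ : e₂ x′ y′ z′ ≡ e₂ x y z + slope * d₂
    step-e₂ = sym (x-y≡0⇒x≡y (x*y≡0⇒y≡0 x′≢y′ (begin
      (x′ - y′) * (e₂ x y z + slope * d₂ - e₂ x′ y′ z′)
        ≡⟨ solve 9 (λ d₁ d₂ d₃ x y z X Y s →
             let H : _ → _
                 H t = (t :- x) :* (t :- y) :* (t :- z) :+ s :* (d₂ :* t :- d₁ :* (t :* t) :- d₃)
                 Z = x :+ y :+ z :+ s :* d₁ :- X :- Y in
             (X :- Y) :* (x :* y :+ x :* z :+ y :* z :+ s :* d₂ :- (X :* Y :+ X :* Z :+ Y :* Z)) := H X :- H Y)
             refl d₁ d₂ d₃ x y z x′ y′ slope ⟩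
      H x′ - H y′ ≡⟨ x≡y⇒x-y≡0 (trans Hx′≡0 (sym Hy′≡0)) ⟩
      0ℚ          ∎)))

    -- With the other two coefficients settled, `H x′ ≡ 0` determines the constant term.
    step-e₃ : e₃ x′ y′ z′ ≡ e₃ x y z + slope * d₃
    step-e₃ = x-y≡0⇒x≡y (begin
      e₃ x′ y′ z′ - (e₃ x y z + slope * d₃)
        ≡⟨ solve 9 (λ d₁ d₂ d₃ x y z X Y s →
             let Z = x :+ y :+ z :+ s :* d₁ :- X :- Y in
             X :* Y :* Z :- (x :* y :* z :+ s :* d₃) :=
             (X :- x) :* (X :- y) :* (X :- z) :+ s :* (d₂ :* X :- d₁ :* (X :* X) :- d₃)
              :+ X :* (X :* Y :+ X :* Z :+ Y :* Z :- (x :* y :+ x :* z :+ y :* z :+ s :* d₂)))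
             refl d₁ d₂ d₃ x y z x′ y′ slope ⟩
      H x′ + x′ * (e₂ x′ y′ z′ - (e₂ x y z + slope * d₂))
        ≡⟨ cong₂ (λ u v → u + x′ * v) Hx′≡0 (x≡y⇒x-y≡0 step-e₂) ⟩
      0ℚ + x′ * 0ℚ ≡⟨ solve 1 (λ x → 𝟘 :+ x :* 𝟘 := 𝟘) refl x′ ⟩
      0ℚ ∎)

-- The degenerate curve

-- For d = (p, -q, 0) and a solution (0, u, v), both h and g vanish at 0. The component of the curve
-- given by x = 0 is then p u v + q (u + v) = C, parametrised by W with u and v exchanged by W ↦ 1 / W.
-- The value of C makes q² + p C the square of k, so that this parametrisation is rational.
module Degenerate (p q : ℚ) where
  k C : ℚ
  k = p + q
  C = q + q + p

  A B : ℚ → ℚ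
  A W = q * W + k
  B W = q + k * W

  u v : ℚ → ℚ
  u W = C * W * inv (A W)
  v W = C * inv (B W)

  record Nondegenerate (W : ℚ) : Set where
    constructor nondegenerate
    field
      k≢0 : k ≢ 0ℚ
      C≢0 : C ≢ 0ℚ
      W≢0 : W ≢ 0ℚ
      A≢0 : A W ≢ 0ℚ
      B≢0 : B W ≢ 0ℚ

  module _ {W : ℚ} (ok : Nondegenerate W) where
    open Nondegenerate ok

    Au : A W * u W ≡ C * W
    Au = x*[y*inv-x]≡y _ A≢0

    Bv : B W * v W ≡ C
    Bv = x*[y*inv-x]≡y _ B≢0

    u≢0 : u W ≢ 0ℚ
    u≢0 u≡0 = *-≢0 C≢0 W≢0 (trans (sym Au) (trans (cong (A W *_) u≡0) (zeroʳ _)))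

    v≢0 : v W ≢ 0ℚ
    v≢0 v≡0 = C≢0 (trans (sym Bv) (trans (cong (B W *_) v≡0) (zeroʳ _)))

    -- Multiplied by `p`, the equation says (p u + q)(p v + q) = k², and the two factors are k B / A
    -- and k A / B. Clearing `A` and `B` directly covers `p = 0` as well.
    on-curve : p * (u W * v W) + q * (u W + v W) ≡ C
    on-curve = *-cancelˡ (*-≢0 A≢0 B≢0) (begin
      A W * B W * (p * (u W * v W) + q * (u W + v W))
        ≡⟨ solve 6 (λ p q A B u v → A :* B :* (p :* (u :* v) :+ q :* (u :+ v)) :=
             p :* ((A :* u) :* (B :* v)) :+ q :* ((A :* u) :* B :+ A :* (B :* v))) refl p q (A W) (B W) (u W) (v W) ⟩
      p * ((A W * u W) * (B W * v W)) + q * ((A W * u W) * B W + A W * (B W * v W))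
        ≡⟨ cong₂ (λ s t → p * (s * t) + q * (s * B W + A W * t)) Au Bv ⟩
      p * ((C * W) * C) + q * ((C * W) * B W + A W * C)
        ≡⟨ solve 3 (λ p q W → let k = p :+ q ; C = q :+ q :+ p ; A = q :* W :+ k ; B = q :+ k :* W in
             p :* ((C :* W) :* C) :+ q :* ((C :* W) :* B :+ A :* C) := A :* B :* C) refl p q W ⟩
      A W * B W * C ∎)

    -- The coordinates agree at the fixed points 1 and -1 of the exchange W ↦ 1 / W, whence the
    -- factor `W * W - 1ℚ`.
    u-v : A W * B W * (u W - v W) ≡ C * k * (W * W - 1ℚ)
    u-v = begin
      A W * B W * (u W - v W)
        ≡⟨ solve 4 (λ A B u v → A :* B :* (u :- v) := (A :* u) :* B :- A :* (B :* v)) refl (A W) (B W) (u W) (v W) ⟩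
      (A W * u W) * B W - A W * (B W * v W)
        ≡⟨ cong₂ (λ s t → s * B W - A W * t) Au Bv ⟩
      (C * W) * B W - A W * C
        ≡⟨ solve 4 (λ p q W C → let k = p :+ q ; A = q :* W :+ k ; B = q :+ k :* W in
             (C :* W) :* B :- A :* C := C :* k :* (W :* W :- 𝟙)) refl p q W C ⟩
      C * k * (W * W - 1ℚ) ∎

    u≢v : W * W - 1ℚ ≢ 0ℚ → u W - v W ≢ 0ℚ
    u≢v W²≢1 eq = *-≢0 (*-≢0 C≢0 k≢0) W²≢1 (trans (sym u-v) (trans (cong (A W * B W *_) eq) (zeroʳ _)))

  module _ {W : ℚ} (ok : Nondegenerate W) (ok³ : Nondegenerate (W * W * W))
    (W²≢1 : W * W - 1ℚ ≢ 0ℚ) (W⁶≢1 : W * W * W * (W * W * W) - 1ℚ ≢ 0ℚ) where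

    open Nondegenerate ok
    open Nondegenerate ok³ using () renaming (A≢0 to A³≢0; B≢0 to B³≢0)

    private
      W³ U V X Y F E : ℚ
      W³ = W * W * W
      U = u W
      V = v W
      X = v W³
      Y = u W³
      F = A W³
      E = B W³

    open Step p (- q) 0ℚ 0ℚ U V
    open StepProperties p (- q) 0ℚ 0ℚ U V using (Regular; regular)

    private
      -- What remains of `ℓ₁` after the factor U²V, which it shares with `ℓ₀`, is removed.
      w : ℚ
      w = p * (U * U * V) + q * (U * U - U * V + V * V)

      U≢0 = u≢0 ok
      V≢0 = v≢0 ok
      AU = Au ok
      BV = Bv ok
      FY = Au ok³
      EX = Bv ok³

      ℓ₁-val : ℓ₁ ≡ U * U * V * w
      ℓ₁-val = solve 4 (λ p q U V → let module M = SolverFormulas.Step p (:- q) 𝟘 𝟘 U V in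
        M.ℓ₁ := U :* U :* V :* (p :* (U :* U :* V) :+ q :* (U :* U :- U :* V :+ V :* V))) refl p q U V

      ℓ₀-val : ℓ₀ ≡ U * U * V * (V * V * V * (p * U + q))
      ℓ₀-val = solve 4 (λ p q U V → let module M = SolverFormulas.Step p (:- q) 𝟘 𝟘 U V in
        M.ℓ₀ := U :* U :* V :* (V :* V :* V :* (p :* U :+ q))) refl p q U V

      -- The cubing enters here: `E` is `B` at W³, and it becomes the denominator of `x′`. All
      -- factors on the right are nonzero, hence so is `w`.
      w-val : A W * A W * (B W * B W) * w ≡ C * C * k * A W * E
      w-val = begin
        A W * A W * (B W * B W) * w
          ≡⟨ solve 6 (λ p q A B U V → A :* A :* (B :* B) :* (p :* (U :* U :* V) :+ q :* (U :* U :- U :* V :+ V :* V)) :=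
               let s = A :* U ; t = B :* V in
               p :* (s :* s :* t :* B) :+ q :* (s :* s :* (B :* B) :- s :* t :* (A :* B) :+ t :* t :* (A :* A)))
               refl p q (A W) (B W) U V ⟩
        p * ((A W * U) * (A W * U) * (B W * V) * B W)
          + q * ((A W * U) * (A W * U) * (B W * B W) - (A W * U) * (B W * V) * (A W * B W) + (B W * V) * (B W * V) * (A W * A W))
          ≡⟨ cong₂ (λ s t → p * (s * s * t * B W)
               + q * (s * s * (B W * B W) - s * t * (A W * B W) + t * t * (A W * A W))) AU BV ⟩
        p * ((C * W) * (C * W) * C * B W)
          + q * ((C * W) * (C * W) * (B W * B W) - (C * W) * C * (A W * B W) + C * C * (A W * A W))
          ≡⟨ solve 3 (λ p q W → let k = p :+ q ; C = q :+ q :+ p ; A = q :* W :+ k ; B = q :+ k :* W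
                                    E = q :+ k :* (W :* W :* W) in
               p :* ((C :* W) :* (C :* W) :* C :* B)
                 :+ q :* ((C :* W) :* (C :* W) :* (B :* B) :- (C :* W) :* C :* (A :* B) :+ C :* C :* (A :* A))
               := C :* C :* k :* A :* E) refl p q W ⟩
        C * C * k * A W * E ∎

      w≢0 : w ≢ 0ℚ
      w≢0 w≡0 = *-≢0 (*-≢0 (*-≢0 (*-≢0 C≢0 C≢0) k≢0) A≢0) B³≢0
        (trans (sym w-val) (trans (cong (A W * A W * (B W * B W) *_) w≡0) (zeroʳ _)))

      pU+q : A W * (p * U + q) ≡ k * B W
      pU+q = begin
        A W * (p * U + q) ≡⟨ solve 4 (λ p q A U → A :* (p :* U :+ q) := p :* (A :* U) :+ q :* A) refl p q (A W) U ⟩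
        p * (A W * U) + q * A W ≡⟨ cong (λ s → p * s + q * A W) AU ⟩
        p * (C * W) + q * A W
          ≡⟨ solve 3 (λ p q W → let k = p :+ q ; C = q :+ q :+ p in
               p :* (C :* W) :+ q :* (q :* W :+ k) := k :* (q :+ k :* W)) refl p q W ⟩
        k * B W ∎

      wX : w * X ≡ V * V * V * (p * U + q)
      wX = *-cancelˡ (*-≢0 (*-≢0 (*-≢0 A≢0 A≢0) (*-≢0 (*-≢0 B≢0 B≢0) B≢0)) B³≢0) (begin
        A W * A W * (B W * B W * B W) * E * (w * X)
          ≡⟨ solve 5 (λ A B E w X → A :* A :* (B :* B :* B) :* E :* (w :* X) :=
               (A :* A :* (B :* B) :* w) :* (E :* X) :* B) refl (A W) (B W) E w X ⟩
        (A W * A W * (B W * B W) * w) * (E * X) * B W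
          ≡⟨ cong₂ (λ s t → s * t * B W) w-val EX ⟩
        (C * C * k * A W * E) * C * B W
          ≡⟨ solve 5 (λ C k A B E → (C :* C :* k :* A :* E) :* C :* B := C :* C :* C :* (k :* B) :* (A :* E)) refl C k (A W) (B W) E ⟩
        C * C * C * (k * B W) * (A W * E)
          ≡⟨ cong₂ (λ s t → s * s * s * t * (A W * E)) BV pU+q ⟨
        (B W * V) * (B W * V) * (B W * V) * (A W * (p * U + q)) * (A W * E)
          ≡⟨ solve 5 (λ A B E V t → (B :* V) :* (B :* V) :* (B :* V) :* (A :* t) :* (A :* E) :=
               A :* A :* (B :* B :* B) :* E :* (V :* V :* V :* t)) refl (A W) (B W) E V (p * U + q) ⟩
        A W * A W * (B W * B W * B W) * E * (V * V * V * (p * U + q)) ∎)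

      UUV≢0 : U * U * V ≢ 0ℚ
      UUV≢0 = *-≢0 (*-≢0 U≢0 U≢0) V≢0

      ℓ₁≢0 : ℓ₁ ≢ 0ℚ
      ℓ₁≢0 eq = *-≢0 UUV≢0 w≢0 (trans (sym ℓ₁-val) eq)

    x′-val : x′ ≡ X
    x′-val = x*z≡y⇒y*inv-x≡z ℓ₁≢0 (begin
      ℓ₁ * X              ≡⟨ cong (_* X) ℓ₁-val ⟩
      U * U * V * w * X   ≡⟨ *-assoc _ w X ⟩
      U * U * V * (w * X) ≡⟨ cong (U * U * V *_) wX ⟩
      _                   ≡⟨ ℓ₀-val ⟨
      ℓ₀                  ∎)

    private
      image : (c * X + d) * Y ≡ a * X + b
      -- Multiplication by this factor leaves `U`, `V`, `X`, `Y` only inside the products A U, B V,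
      -- E X, F Y, which are polynomials in `W`.
      image = *-cancelˡ (*-≢0 (*-≢0 (*-≢0 A≢0 A≢0) (*-≢0 B≢0 B≢0)) (*-≢0 A³≢0 B³≢0)) (begin
        A W * A W * (B W * B W) * (F * E) * ((c * X + d) * Y)
          ≡⟨ solve 8 (λ A B E F U V X Y → let module M = SolverFormulas.Möbius 𝟘 U V in
               A :* A :* (B :* B) :* (F :* E) :* ((M.c :* X :+ M.d) :* Y) :=
               let μ = A :* U ; ν = B :* V ; x = E :* X ; y = F :* Y in
               y :* ((μ :* μ :* (B :* B) :- μ :* ν :* (A :* B) :+ ν :* ν :* (A :* A)) :* x :- μ :* (ν :* ν) :* (E :* A)))
               refl (A W) (B W) E F U V X Y ⟩
        (F * Y) * ((μ * μ * (B W * B W) - μ * ν * (A W * B W) + ν * ν * (A W * A W)) * (E * X) - μ * (ν * ν) * (E * A W))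
          ≡⟨ cong₂ (λ y x → y * ((μ * μ * (B W * B W) - μ * ν * (A W * B W) + ν * ν * (A W * A W)) * x - μ * (ν * ν) * (E * A W))) FY EX ⟩
        (C * W³) * ((μ * μ * (B W * B W) - μ * ν * (A W * B W) + ν * ν * (A W * A W)) * C - μ * (ν * ν) * (E * A W))
          ≡⟨ cong₂ (λ μ ν → (C * W³) * ((μ * μ * (B W * B W) - μ * ν * (A W * B W) + ν * ν * (A W * A W)) * C - μ * (ν * ν) * (E * A W))) AU BV ⟩
        (C * W³) * (((C * W) * (C * W) * (B W * B W) - (C * W) * C * (A W * B W) + C * C * (A W * A W)) * C - (C * W) * (C * C) * (E * A W))
          ≡⟨ solve 4 (λ p q W C → let k = p :+ q ; A = q :* W :+ k ; B = q :+ k :* W ; W³ = W :* W :* W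
                                      E = q :+ k :* W³ ; F = q :* W³ :+ k in
               (C :* W³) :* (((C :* W) :* (C :* W) :* (B :* B) :- (C :* W) :* C :* (A :* B) :+ C :* C :* (A :* A)) :* C :- (C :* W) :* (C :* C) :* (E :* A))
               := (C :* W) :* (C :* W) :* C :* F :* (C :* B :- E :* C)) refl p q W C ⟩
        (C * W) * (C * W) * C * F * (C * B W - E * C)
          ≡⟨ cong₂ (λ μ ν → μ * μ * ν * F * (C * B W - E * ν)) AU BV ⟨
        μ * μ * ν * F * (C * B W - E * ν)
          ≡⟨ cong (λ x → μ * μ * ν * F * (x * B W - E * ν)) EX ⟨
        μ * μ * ν * F * ((E * X) * B W - E * ν)
          ≡⟨ solve 7 (λ A B E F U V X → let module M = SolverFormulas.Möbius 𝟘 U V in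
               let μ = A :* U ; ν = B :* V in
               μ :* μ :* ν :* F :* ((E :* X) :* B :- E :* ν) := A :* A :* (B :* B) :* (F :* E) :* (M.a :* X :+ M.b))
               refl (A W) (B W) E F U V X ⟩
        A W * A W * (B W * B W) * (F * E) * (a * X + b) ∎)
        where
        μ = A W * U
        ν = B W * V

      -- If the denominator vanished at `X`, then by `image` so would the numerator, and with them
      -- the determinant of M. That determinant is the discriminant of 0, `U`, `V`.
      pole≢X : c * X + d ≢ 0ℚ
      pole≢X N≡0 = *-≢0 UV≢0 (*-≢0 UV≢0 (*-≢0 U≢V U≢V)) (begin
        U * V * (U * V * ((U - V) * (U - V)))
          ≡⟨ solve 3 (λ U V X → let module M = SolverFormulas.Möbius 𝟘 U V in
               U :* V :* (U :* V :* ((U :- V) :* (U :- V))) := M.a :* (M.c :* X :+ M.d) :- M.c :* (M.a :* X :+ M.b)) refl U V X ⟩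
        a * (c * X + d) - c * (a * X + b)
          ≡⟨ cong (λ P → a * (c * X + d) - c * P) image ⟨
        a * (c * X + d) - c * ((c * X + d) * Y)
          ≡⟨ cong (λ N → a * N - c * (N * Y)) N≡0 ⟩
        a * 0ℚ - c * (0ℚ * Y)
          ≡⟨ solve 3 (λ a c Y → a :* 𝟘 :- c :* (𝟘 :* Y) := 𝟘) refl a c Y ⟩
        0ℚ ∎)
        where
        UV≢0 = *-≢0 U≢0 V≢0
        U≢V = u≢v ok W²≢1

      pole≢x′ : c * x′ + d ≢ 0ℚ
      pole≢x′ = subst (λ X → c * X + d ≢ 0ℚ) (sym x′-val) pole≢X

    y′-val : y′ ≡ Y
    y′-val = x*z≡y⇒y*inv-x≡z pole≢x′ (subst (λ X → (c * X + d) * Y ≡ a * X + b) (sym x′-val) image)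

    private
      pX+q : E * (p * X + q) ≡ k * F
      pX+q = begin
        E * (p * X + q) ≡⟨ solve 4 (λ p q E X → E :* (p :* X :+ q) := p :* (E :* X) :+ q :* E) refl p q E X ⟩
        p * (E * X) + q * E ≡⟨ cong (λ s → p * s + q * E) EX ⟩
        p * C + q * E
          ≡⟨ solve 3 (λ p q W³ → let k = p :+ q in
               p :* (q :+ q :+ p) :+ q :* (q :+ k :* W³) := k :* (q :* W³ :+ k)) refl p q W³ ⟩
        k * F ∎

      pX+q≢0 : p * X + q ≢ 0ℚ
      pX+q≢0 eq = *-≢0 k≢0 A³≢0 (trans (sym pX+q) (trans (cong (E *_) eq) (zeroʳ _)))

      -gX : X * (p * X + q) ≡ - g X
      -gX = solve 3 (λ p q X → X :* (p :* X :+ q) := :- ((:- q) :* X :- p :* (X :* X) :- 𝟘)) refl p q X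

      g≢0 : g x′ ≢ 0ℚ
      g≢0 eq = *-≢0 (v≢0 ok³) pX+q≢0
        (trans -gX (trans (cong (-_ ∘ g) (sym x′-val)) (trans (cong -_ eq) -0≡0)))

    -- As a common root of `h` and `g`, 0 is a root of every member of the pencil and stays the
    -- third root. The calculation reduces to (U, V) and (Y, X) lying on the curve with the same
    -- constant `C`.
    z′-val : z′ ≡ 0ℚ
    z′-val = x*y≡0⇒y≡0 g≢0 (begin
      g x′ * z′
        ≡⟨ solve 7 (λ g U V s p x y → g :* (𝟘 :+ U :+ V :+ s :* p :- x :- y) :=
             g :* (U :+ V :- x :- y) :+ (g :* s) :* p) refl (g x′) U V slope p x′ y′ ⟩
      g x′ * (U + V - x′ - y′) + (g x′ * slope) * p
        ≡⟨ cong (λ s → g x′ * (U + V - x′ - y′) + s * p) (x*[y*inv-x]≡y (- h x′) g≢0) ⟩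
      g x′ * (U + V - x′ - y′) + (- h x′) * p
        ≡⟨ cong₂ (λ x y → g x * (U + V - x - y) + (- h x) * p) x′-val y′-val ⟩
      g X * (U + V - X - Y) + (- h X) * p
        ≡⟨ solve 6 (λ p q U V X Y → let module M = SolverFormulas.Step p (:- q) 𝟘 𝟘 U V in
             M.g X :* (U :+ V :- X :- Y) :+ (:- M.h X) :* p :=
             X :* (p :* (Y :* X) :+ q :* (Y :+ X) :- (p :* (U :* V) :+ q :* (U :+ V)))) refl p q U V X Y ⟩
      X * (p * (Y * X) + q * (Y + X) - (p * (U * V) + q * (U + V)))
        ≡⟨ cong₂ (λ s t → X * (s - t)) (on-curve ok³) (on-curve ok) ⟩
      X * (C - C) ≡⟨ solve 2 (λ X C → X :* (C :- C) := 𝟘) refl X C ⟩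
      0ℚ ∎)

    step-regular : Regular
    step-regular = regular ℓ₁≢0 pole≢x′ g≢0 λ eq → u≢v ok³ W⁶≢1 (begin
      Y - X         ≡⟨ solve 2 (λ X Y → Y :- X := :- (X :- Y)) refl X Y ⟩
      - (X - Y)     ≡⟨ cong₂ (λ x y → - (x - y)) x′-val y′-val ⟨
      - (x′ - y′)   ≡⟨ cong -_ eq ⟩
      - 0ℚ          ≡⟨ -0≡0 ⟩
      0ℚ            ∎)

-- Density of the complement of a hypersurface

horner : List ℚ → ℚ → ℚ
horner []       s = 0ℚ
horner (c ∷ cs) s = c + s * horner cs s

addL : List ℚ → List ℚ → List ℚ
addL []       ds       = ds
addL (c ∷ cs) []       = c ∷ cs
addL (c ∷ cs) (d ∷ ds) = c + d ∷ addL cs ds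

scaleL : ℚ → List ℚ → List ℚ
scaleL a = List.map (a *_)

mulL : List ℚ → List ℚ → List ℚ
mulL []       ds = []
mulL (c ∷ cs) ds = addL (scaleL c ds) (0ℚ ∷ mulL cs ds)

horner-addL : ∀ cs ds s → horner (addL cs ds) s ≡ horner cs s + horner ds s
horner-addL []       ds       s = solve 1 (λ x → x := 𝟘 :+ x) refl _
horner-addL (c ∷ cs) []       s = solve 1 (λ x → x := x :+ 𝟘) refl _
horner-addL (c ∷ cs) (d ∷ ds) s = begin
  c + d + s * horner (addL cs ds) s
    ≡⟨ cong (λ h → c + d + s * h) (horner-addL cs ds s) ⟩
  c + d + s * (horner cs s + horner ds s)
    ≡⟨ solve 5 (λ c d s x y → c :+ d :+ s :* (x :+ y) := c :+ s :* x :+ (d :+ s :* y)) refl c d s _ _ ⟩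
  c + s * horner cs s + (d + s * horner ds s) ∎

horner-scaleL : ∀ a cs s → horner (scaleL a cs) s ≡ a * horner cs s
horner-scaleL a []       s = sym (zeroʳ a)
horner-scaleL a (c ∷ cs) s = trans (cong (λ h → a * c + s * h) (horner-scaleL a cs s))
  (solve 4 (λ a c s x → a :* c :+ s :* (a :* x) := a :* (c :+ s :* x)) refl a c s _)

horner-mulL : ∀ cs ds s → horner (mulL cs ds) s ≡ horner cs s * horner ds s
horner-mulL []       ds s = sym (zeroˡ _)
horner-mulL (c ∷ cs) ds s = begin
  horner (addL (scaleL c ds) (0ℚ ∷ mulL cs ds)) s
    ≡⟨ horner-addL (scaleL c ds) _ s ⟩
  horner (scaleL c ds) s + (0ℚ + s * horner (mulL cs ds) s)
    ≡⟨ cong₂ (λ u v → u + (0ℚ + s * v)) (horner-scaleL c ds s) (horner-mulL cs ds s) ⟩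
  c * horner ds s + (0ℚ + s * (horner cs s * horner ds s))
    ≡⟨ solve 4 (λ c s x y → c :* y :+ (𝟘 :+ s :* (x :* y)) := (c :+ s :* x) :* y) refl c s _ _ ⟩
  (c + s * horner cs s) * horner ds s ∎

-- Synthetic division by `s - a`; the remainder is the value at `a`.
quotient : List ℚ → ℚ → List ℚ
quotient []               a = []
quotient (c ∷ [])         a = []
quotient (c ∷ cs@(_ ∷ _)) a = horner cs a ∷ quotient cs a

length-quotient : ∀ c cs a → length (quotient (c ∷ cs) a) ≡ length cs
length-quotient c []       a = refl
length-quotient c (d ∷ cs) a = cong suc (length-quotient d cs a)

horner-quotient : ∀ cs a s → horner cs s ≡ horner cs a + (s - a) * horner (quotient cs a) s
horner-quotient []               a s = solve 2 (λ a s → 𝟘 := 𝟘 :+ (s :- a) :* 𝟘) refl a s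
horner-quotient (c ∷ [])         a s =
  solve 3 (λ c a s → c :+ s :* 𝟘 := c :+ a :* 𝟘 :+ (s :- a) :* 𝟘) refl c a s
horner-quotient (c ∷ cs@(_ ∷ _)) a s = begin
  c + s * horner cs s
    ≡⟨ cong (λ h → c + s * h) (horner-quotient cs a s) ⟩
  c + s * (horner cs a + (s - a) * horner (quotient cs a) s)
    ≡⟨ solve 5 (λ c a s h q → c :+ s :* (h :+ (s :- a) :* q) := c :+ a :* h :+ (s :- a) :* (h :+ s :* q)) refl c a s _ _ ⟩
  c + a * horner cs a + (s - a) * (horner cs a + s * horner (quotient cs a) s) ∎

horner-root : ∀ cs {a} s → horner cs a ≡ 0ℚ → horner cs s ≡ (s - a) * horner (quotient cs a) s
horner-root cs {a} s eq = trans (horner-quotient cs a s)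
  (trans (cong (_+ (s - a) * horner (quotient cs a) s) eq) (solve 1 (λ x → 𝟘 :+ x := x) refl _))

-- Split off the root `K`: the quotient is shorter and still vanishes at all naturals beyond `K`.
vanishing : ∀ n cs → length cs ≡ n → ∀ K → (∀ k → K ≤ k → horner cs (fromℕ k) ≡ 0ℚ) → ∀ s → horner cs s ≡ 0ℚ
vanishing n       []       len K van s = refl
vanishing (suc n) (c ∷ cs) len K van s = begin
  horner (c ∷ cs) s          ≡⟨ horner-root (c ∷ cs) s (van K ℕ.≤-refl) ⟩
  (s - fromℕ K) * horner q s ≡⟨ cong ((s - fromℕ K) *_) q≡0 ⟩
  (s - fromℕ K) * 0ℚ         ≡⟨ zeroʳ _ ⟩
  0ℚ                         ∎
  where
  q = quotient (c ∷ cs) (fromℕ K)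

  q≡0 : horner q s ≡ 0ℚ
  q≡0 = vanishing n q (trans (length-quotient c cs _) (ℕ.suc-injective len)) (suc K)
    (λ k K<k → x*y≡0⇒y≡0 (λ k-K≡0 → ℕ.<⇒≢ K<k (sym (fromℕ-injective (x-y≡0⇒x≡y k-K≡0))))
      (trans (sym (horner-root (c ∷ cs) (fromℕ k) (van K ℕ.≤-refl))) (van k (ℕ.<⇒≤ K<k)))) s

-- Either no natural number is a root, or a root `a` can be divided out and the quotient has a bound
-- by induction. Which case holds is not decided, hence the double negation; `density` can discharge
-- it because equality in ℚ is decidable.
eventually-nonzero : ∀ n cs → length cs ≡ n → ∀ s → horner cs s ≢ 0ℚ →
  ¬ ¬ (∃[ K ] ∀ k → K ≤ k → horner cs (fromℕ k) ≢ 0ℚ)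
eventually-nonzero n       []       len s nz _   = nz refl
eventually-nonzero (suc n) (c ∷ cs) len s nz ¬ev = ¬ev (0 , λ a _ root →
  let q = quotient (c ∷ cs) (fromℕ a)
      factor t = horner-root (c ∷ cs) t root
  in eventually-nonzero n q (trans (length-quotient c cs _) (ℕ.suc-injective len)) s
    (λ q≡0 → nz (trans (factor s) (trans (cong (_ *_) q≡0) (zeroʳ _))))
    λ (K , q≢0) → ¬ev (K ⊔ suc a , λ k le eq → *-≢0
      (λ k-a≡0 → ℕ.<⇒≢ (ℕ.m⊔n≤o⇒n≤o K (suc a) le) (sym (fromℕ-injective (x-y≡0⇒x≡y k-a≡0))))
      (q≢0 k (ℕ.m⊔n≤o⇒m≤o K (suc a) le)) (trans (sym (factor (fromℕ k))) eq)))

module _ {n} (ρ ρ′ : Fin n → ℚ) where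
  -- Coefficients, constant term first, in the parameter `s` of the line that is at `ρ` for `s = 0`
  -- and at `ρ′` for `s = 1`.
  restrict : Poly n → List ℚ
  restrict (con c) = c ∷ []
  restrict (var k) = ρ k ∷ ρ′ k - ρ k ∷ []
  restrict (p ⊕ q) = addL (restrict p) (restrict q)
  restrict (p ⊗ q) = mulL (restrict p) (restrict q)
  restrict (⊖ p)   = scaleL (- 1ℚ) (restrict p)

  -- The point `τ` is given by pointwise equations, so that the two ends of the line can be inserted
  -- without an equality of functions.
  horner-restrict : ∀ s τ → (∀ k → τ k ≡ ρ k + s * (ρ′ k - ρ k)) → ∀ p → horner (restrict p) s ≡ eval p τ
  horner-restrict s τ eq (con c) = solve 2 (λ c s → c :+ s :* 𝟘 := c) refl c s
  horner-restrict s τ eq (var k) =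
    trans (solve 3 (λ x y s → x :+ s :* (y :+ s :* 𝟘) := x :+ s :* y) refl _ _ s) (sym (eq k))
  horner-restrict s τ eq (p ⊕ q) = trans (horner-addL (restrict p) (restrict q) s)
    (trans (cong₂ _+_ (horner-restrict s τ eq p) (horner-restrict s τ eq q)) (sym (+-def _ _)))
  horner-restrict s τ eq (p ⊗ q) = trans (horner-mulL (restrict p) (restrict q) s)
    (trans (cong₂ _*_ (horner-restrict s τ eq p) (horner-restrict s τ eq q)) (sym (*-def _ _)))
  horner-restrict s τ eq (⊖ p)   = begin
    horner (scaleL (- 1ℚ) (restrict p)) s ≡⟨ horner-scaleL (- 1ℚ) (restrict p) s ⟩
    - 1ℚ * horner (restrict p) s          ≡⟨ solve 1 (λ x → :- 𝟙 :* x := :- x) refl _ ⟩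
    - horner (restrict p) s               ≡⟨ cong -_ (horner-restrict s τ eq p) ⟩
    - eval p τ                            ≡⟨ neg-def _ ⟨
    ℚ.- eval p τ                          ∎

-- On the line from `ρ` to `τ`, `q` is not identically zero, so `p` vanishes at all large natural
-- parameters, hence on the whole line and at `τ`.
density : ∀ {n} (p q : Poly n) {ρ} → eval q ρ ≢ 0ℚ → (∀ τ → eval q τ ≢ 0ℚ → eval p τ ≡ 0ℚ) → ∀ τ → eval p τ ≡ 0ℚ
density p q {ρ} q[ρ]≢0 p≡0 τ = decidable-stable (eval p τ ℚ.≟ 0ℚ) λ p[τ]≢0 →
  eventually-nonzero _ (restrict ρ τ q) refl 0ℚ
    (q[ρ]≢0 ∘ trans (sym (horner-restrict ρ τ 0ℚ ρ (λ k → solve 2 (λ x y → x := x :+ 𝟘 :* (y :- x)) refl _ _) q)))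
    λ (K , q≢0) → p[τ]≢0 (trans
      (sym (horner-restrict ρ τ 1ℚ τ (λ k → solve 2 (λ x y → y := x :+ 𝟙 :* (y :- x)) refl (ρ k) (τ k)) p))
      (vanishing _ (restrict ρ τ p) refl K (λ k K≤k → trans (on-line k p)
        (p≡0 _ (q≢0 k K≤k ∘ trans (on-line k q)))) 1ℚ))
  where
  on-line : ∀ k p → horner (restrict ρ τ p) (fromℕ k) ≡ eval p (λ i → ρ i + fromℕ k * (τ i - ρ i))
  on-line k = horner-restrict ρ τ (fromℕ k) _ (λ _ → refl)

-- Values of rational functions

eval-⊕ : ∀ {n} (p q : Poly n) ρ → eval (p ⊕ q) ρ ≡ eval p ρ + eval q ρ
eval-⊕ p q ρ = +-def _ _

eval-⊗ : ∀ {n} (p q : Poly n) ρ → eval (p ⊗ q) ρ ≡ eval p ρ * eval q ρ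
eval-⊗ p q ρ = *-def _ _

eval-⊗-≢0 : ∀ {n} (p q : Poly n) ρ → eval p ρ ≢ 0ℚ → eval q ρ ≢ 0ℚ → eval (p ⊗ q) ρ ≢ 0ℚ
eval-⊗-≢0 p q ρ p≢0 q≢0 eq = *-≢0 p≢0 q≢0 (trans (sym (eval-⊗ p q ρ)) eq)

eval-⊗-≢0⁻¹ : ∀ {n} (p q : Poly n) ρ → eval (p ⊗ q) ρ ≢ 0ℚ → eval p ρ ≢ 0ℚ × eval q ρ ≢ 0ℚ
eval-⊗-≢0⁻¹ p q ρ pq≢0 =
  (λ p≡0 → pq≢0 (trans (eval-⊗ p q ρ) (trans (cong (_* eval q ρ) p≡0) (zeroˡ _)))) ,
  (λ q≡0 → pq≢0 (trans (eval-⊗ p q ρ) (trans (cong (eval p ρ *_) q≡0) (zeroʳ _))))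

record HasValue {n} (ρ : Fin n → ℚ) (f : RatFun n) (v : ℚ) : Set where
  constructor hasValue
  field
    den≢0 : eval (den f) ρ ≢ 0ℚ
    num≡  : eval (num f) ρ ≡ v * eval (den f) ρ
open HasValue

const : ∀ {n} → ℚ → RatFun n
const c = con c // con 1ℚ

negR invR : ∀ {n} → RatFun n → RatFun n
negR (a // b) = (⊖ a) // b
invR (a // b) = b // a

module _ {n} {ρ : Fin n → ℚ} where

  0R-value : HasValue ρ 0R 0ℚ
  0R-value = hasValue (λ ()) (sym (zeroˡ _))

  1R-value : HasValue ρ 1R 1ℚ
  1R-value = hasValue (λ ()) (sym (*-identityˡ _))

  t-value : ∀ k → HasValue ρ (t k) (ρ k)
  t-value k = hasValue (λ ()) (sym (*-identityʳ _))

  con-value : ∀ c → HasValue ρ (const c) c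
  con-value c = hasValue (λ ()) (sym (*-identityʳ _))

  +R-value : ∀ {f g v w} → HasValue ρ f v → HasValue ρ g w → HasValue ρ (f +R g) (v + w)
  +R-value {a // b} {c // d} {v} {w} (hasValue b≢0 a≡) (hasValue d≢0 c≡) =
    hasValue (eval-⊗-≢0 b d ρ b≢0 d≢0) (begin
      eval ((a ⊗ d) ⊕ (c ⊗ b)) ρ
        ≡⟨ trans (eval-⊕ (a ⊗ d) (c ⊗ b) ρ) (cong₂ _+_ (eval-⊗ a d ρ) (eval-⊗ c b ρ)) ⟩
      eval a ρ * eval d ρ + eval c ρ * eval b ρ
        ≡⟨ cong₂ (λ x y → x * eval d ρ + y * eval b ρ) a≡ c≡ ⟩
      v * eval b ρ * eval d ρ + w * eval d ρ * eval b ρ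
        ≡⟨ solve 4 (λ v w b d → v :* b :* d :+ w :* d :* b := (v :+ w) :* (b :* d)) refl v w _ _ ⟩
      (v + w) * (eval b ρ * eval d ρ)
        ≡⟨ cong ((v + w) *_) (eval-⊗ b d ρ) ⟨
      (v + w) * eval (b ⊗ d) ρ ∎)

  *R-value : ∀ {f g v w} → HasValue ρ f v → HasValue ρ g w → HasValue ρ (f *R g) (v * w)
  *R-value {a // b} {c // d} {v} {w} (hasValue b≢0 a≡) (hasValue d≢0 c≡) =
    hasValue (eval-⊗-≢0 b d ρ b≢0 d≢0) (begin
      eval (a ⊗ c) ρ                      ≡⟨ eval-⊗ a c ρ ⟩
      eval a ρ * eval c ρ                 ≡⟨ cong₂ _*_ a≡ c≡ ⟩
      v * eval b ρ * (w * eval d ρ)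
        ≡⟨ solve 4 (λ v w b d → v :* b :* (w :* d) := v :* w :* (b :* d)) refl v w _ _ ⟩
      v * w * (eval b ρ * eval d ρ)       ≡⟨ cong (v * w *_) (eval-⊗ b d ρ) ⟨
      v * w * eval (b ⊗ d) ρ              ∎)

  negR-value : ∀ {f v} → HasValue ρ f v → HasValue ρ (negR f) (- v)
  negR-value {a // b} {v} (hasValue b≢0 a≡) = hasValue b≢0 (begin
    ℚ.- eval a ρ       ≡⟨ neg-def _ ⟩
    - eval a ρ         ≡⟨ cong -_ a≡ ⟩
    - (v * eval b ρ)   ≡⟨ solve 2 (λ v b → :- (v :* b) := :- v :* b) refl v _ ⟩
    - v * eval b ρ     ∎)

  num≢0⇒value≢0 : ∀ {f v} → HasValue ρ f v → eval (num f) ρ ≢ 0ℚ → v ≢ 0ℚ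
  num≢0⇒value≢0 {a // b} (hasValue b≢0 a≡) a≢0 v≡0 = a≢0 (trans a≡ (trans (cong (_* eval b ρ) v≡0) (zeroˡ _)))

  value≢0⇒num≢0 : ∀ {f v} → HasValue ρ f v → v ≢ 0ℚ → eval (num f) ρ ≢ 0ℚ
  value≢0⇒num≢0 (hasValue b≢0 a≡) v≢0 a≡0 = *-≢0 v≢0 b≢0 (trans (sym a≡) a≡0)

  invR-value : ∀ {f v} → HasValue ρ f v → v ≢ 0ℚ → HasValue ρ (invR f) (inv v)
  invR-value {a // b} {v} fv@(hasValue b≢0 a≡) v≢0 = hasValue (value≢0⇒num≢0 fv v≢0) (begin
    eval b ρ                 ≡⟨ *-identityˡ _ ⟨
    1ℚ * eval b ρ            ≡⟨ cong (_* eval b ρ) (*-inv v≢0) ⟨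
    v * inv v * eval b ρ     ≡⟨ solve 3 (λ v i b → v :* i :* b := i :* (v :* b)) refl v _ _ ⟩
    inv v * (v * eval b ρ)   ≡⟨ cong (inv v *_) a≡ ⟨
    inv v * eval a ρ         ∎)

  ≈R⇒value≡ : ∀ {f g v w} → f ≈R g → HasValue ρ f v → HasValue ρ g w → v ≡ w
  ≈R⇒value≡ {a // b} {c // d} {v} {w} f≈g (hasValue b≢0 a≡) (hasValue d≢0 c≡) = *-cancelˡ (*-≢0 b≢0 d≢0) (begin
    eval b ρ * eval d ρ * v   ≡⟨ solve 3 (λ b d v → b :* d :* v := v :* b :* d) refl _ _ v ⟩
    v * eval b ρ * eval d ρ   ≡⟨ cong (_* eval d ρ) a≡ ⟨
    eval a ρ * eval d ρ       ≡⟨ eval-⊗ a d ρ ⟨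
    eval (a ⊗ d) ρ            ≡⟨ f≈g ρ ⟩
    eval (c ⊗ b) ρ            ≡⟨ eval-⊗ c b ρ ⟩
    eval c ρ * eval b ρ       ≡⟨ cong (_* eval b ρ) c≡ ⟩
    w * eval d ρ * eval b ρ   ≡⟨ solve 3 (λ b d w → w :* d :* b := b :* d :* w) refl _ _ w ⟩
    eval b ρ * eval d ρ * w   ∎)

-- The numerator of the difference of `f` and `g` vanishes wherever `q` does not, so `density`
-- applies to it.
value-unique⇒≈ : ∀ {n} (f g : RatFun n) (q : Poly n) {ρ} → eval q ρ ≢ 0ℚ →
  (∀ τ → eval q τ ≢ 0ℚ → ∃[ v ] HasValue τ f v × HasValue τ g v) → f ≈R g
value-unique⇒≈ (a // b) (c // d) q q[ρ]≢0 vals τ = x-y≡0⇒x≡y (trans (sym (diff τ)) (density r q q[ρ]≢0 r≡0 τ))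
  where
  r = (a ⊗ d) ⊕ (⊖ (c ⊗ b))

  diff : ∀ τ → eval r τ ≡ eval (a ⊗ d) τ - eval (c ⊗ b) τ
  diff τ = trans (eval-⊕ (a ⊗ d) (⊖ (c ⊗ b)) τ) (cong (eval (a ⊗ d) τ +_) (neg-def _))

  r≡0 : ∀ τ → eval q τ ≢ 0ℚ → eval r τ ≡ 0ℚ
  r≡0 τ q≢0 with v , hasValue _ a≡ , hasValue _ c≡ ← vals τ q≢0 = trans (diff τ) (x≡y⇒x-y≡0 (begin
    eval (a ⊗ d) τ          ≡⟨ eval-⊗ a d τ ⟩
    eval a τ * eval d τ     ≡⟨ cong (_* eval d τ) a≡ ⟩
    v * eval b τ * eval d τ ≡⟨ solve 3 (λ v b d → v :* b :* d := v :* d :* b) refl v _ _ ⟩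
    v * eval d τ * eval b τ ≡⟨ cong (_* eval b τ) c≡ ⟨
    eval c τ * eval b τ     ≡⟨ eval-⊗ c b τ ⟨
    eval (c ⊗ b) τ          ∎))

-- Elementary symmetric functions with three variables split off

esym : ∀ {m} → ℕ → (Fin m → ℚ) → ℚ
esym         zero    v = 1ℚ
esym {zero}  (suc k) v = 0ℚ
esym {suc m} (suc k) v = esym (suc k) (v ∘ suc) + v zero * esym k (v ∘ suc)

σ-value : ∀ {n} {ρ : Fin n → ℚ} {m} k {x : Fin m → RatFun n} {v} →
  (∀ i → HasValue ρ (x i) (v i)) → HasValue ρ (σ k x) (esym k v)
σ-value {m = m}     zero    x-v = 1R-value
σ-value {m = zero}  (suc k) x-v = 0R-value
σ-value {m = suc m} (suc k) {x} x-v = +R-value {f = σ (suc k) (x ∘ suc)} {g = x zero *R σ k (x ∘ suc)}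
  (σ-value (suc k) (x-v ∘ suc)) (*R-value {f = x zero} {g = σ k (x ∘ suc)} (x-v zero) (σ-value k (x-v ∘ suc)))

-- Lowers the index by one; `z` is the value at index -1.
shift : {A : Set} → A → (ℕ → A) → ℕ → A
shift z f zero    = z
shift z f (suc k) = f k

extend : ∀ {A : Set} {m} → A × A × A → (Fin m → A) → Fin (3 ℕ.+ m) → A
extend (x , y , z) r zero                = x
extend (x , y , z) r (suc zero)          = y
extend (x , y , z) r (suc (suc zero))    = z
extend (x , y , z) r (suc (suc (suc k))) = r k

module _ {m} (x y z : ℚ) (r : Fin m → ℚ) where
  private
    S S₁ S₂ S₃ : ℕ → ℚ
    S k = esym k r
    S₁ = shift 0ℚ S
    S₂ = shift 0ℚ S₁
    S₃ = shift 0ℚ S₂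

  -- The coefficient of Tᵏ in (1 + xT)(1 + yT)(1 + zT) times the generating polynomial of `r`. This
  -- makes both equations linear in the symmetric functions of `x`, `y`, `z`.
  esym-extend : ∀ k → esym k (extend (x , y , z) r) ≡
    S k + (S₁ k * (x + y + z) + S₂ k * (x * y + x * z + y * z) + S₃ k * (x * y * z))
  esym-extend 0 = solve 3 (λ x y z → 𝟙 := 𝟙 :+
    (𝟘 :* (x :+ y :+ z) :+ 𝟘 :* (x :* y :+ x :* z :+ y :* z) :+ 𝟘 :* (x :* y :* z))) refl x y z
  esym-extend 1 = solve 4 (λ x y z s → s :+ z :* 𝟙 :+ y :* 𝟙 :+ x :* 𝟙 := s :+
    (𝟙 :* (x :+ y :+ z) :+ 𝟘 :* (x :* y :+ x :* z :+ y :* z) :+ 𝟘 :* (x :* y :* z))) refl x y z (S 1)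
  esym-extend 2 = solve 5 (λ x y z s s₁ →
    s :+ z :* s₁ :+ y :* (s₁ :+ z :* 𝟙) :+ x :* (s₁ :+ z :* 𝟙 :+ y :* 𝟙) := s :+
    (s₁ :* (x :+ y :+ z) :+ 𝟙 :* (x :* y :+ x :* z :+ y :* z) :+ 𝟘 :* (x :* y :* z))) refl x y z (S 2) (S 1)
  esym-extend (suc (suc (suc k))) = solve 7 (λ x y z s s₁ s₂ s₃ →
    s :+ z :* s₁ :+ y :* (s₁ :+ z :* s₂) :+ x :* (s₁ :+ z :* s₂ :+ y :* (s₂ :+ z :* s₃)) := s :+
    (s₁ :* (x :+ y :+ z) :+ s₂ :* (x :* y :+ x :* z :+ y :* z) :+ s₃ :* (x :* y :* z)))
    refl x y z (S (3 ℕ.+ k)) (S (2 ℕ.+ k)) (S (1 ℕ.+ k)) (S k)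

HasValue³ : ∀ {n} → (Fin n → ℚ) → RatFun n × RatFun n × RatFun n → ℚ × ℚ × ℚ → Set
HasValue³ ρ (f , g , h) (u , v , w) = HasValue ρ f u × HasValue ρ g v × HasValue ρ h w

tail³ : ∀ {A : Set} {m} → (Fin (3 ℕ.+ m) → A) → Fin m → A
tail³ ρ k = ρ (suc (suc (suc k)))

head³ : ∀ {A : Set} {m} → (Fin (3 ℕ.+ m) → A) → A × A × A
head³ ρ = ρ zero , ρ (suc zero) , ρ (suc (suc zero))

extend-value : ∀ {m} {ρ : Fin (3 ℕ.+ m) → ℚ} {x v} → HasValue³ ρ x v →
  ∀ k → HasValue ρ (extend x (tail³ t) k) (extend v (tail³ ρ) k)
extend-value (x-v , y-v , z-v) zero                = x-v
extend-value (x-v , y-v , z-v) (suc zero)          = y-v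
extend-value (x-v , y-v , z-v) (suc (suc zero))    = z-v
extend-value (x-v , y-v , z-v) (suc (suc (suc k))) = t-value _

-- The right side reassembles `ρ` from its parts, which gives `ρ` back only entrywise; this avoids
-- an equality of functions.
σ-preserved : ∀ {m} → ℕ → (Fin (3 ℕ.+ m) → ℚ) → ℚ × ℚ × ℚ → Set
σ-preserved k ρ v = esym k (extend v (tail³ ρ)) ≡ esym k (extend (head³ ρ) (tail³ ρ))

-- It is enough to follow the values of the solutions at generic points, and to separate them at a single point.
record Family (m i j : ℕ) : Set where
  field
    member     : ℕ → RatFun (3 ℕ.+ m) × RatFun (3 ℕ.+ m) × RatFun (3 ℕ.+ m)
    value      : (Fin (3 ℕ.+ m) → ℚ) → ℕ → ℚ × ℚ × ℚ
    guard      : ℕ → Poly (3 ℕ.+ m)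
    has-value  : ∀ ρ l → eval (guard l) ρ ≢ 0ℚ → HasValue³ ρ (member l) (value ρ l)
    σᵢ         : ∀ ρ l → eval (guard l) ρ ≢ 0ℚ → σ-preserved i ρ (value ρ l)
    σⱼ         : ∀ ρ l → eval (guard l) ρ ≢ 0ℚ → σ-preserved j ρ (value ρ l)
    base       : Fin (3 ℕ.+ m) → ℚ
    guard-base : ∀ l → eval (guard l) base ≢ 0ℚ
    injective  : ∀ {l l′} → value base l ≡ value base l′ → l ≡ l′

module _ {m i j} (F : Family m i j) where
  open Family F

  solution : ℕ → Fin (3 ℕ.+ m) → RatFun (3 ℕ.+ m)
  solution l = extend (member l) (tail³ t)

  private
    σ-solution : ∀ k l → (∀ ρ → eval (guard l) ρ ≢ 0ℚ → σ-preserved k ρ (value ρ l)) → σ k (solution l) ≈R σ k t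
    σ-solution k l pres = value-unique⇒≈ (σ k (solution l)) (σ k t) (guard l) (guard-base l) λ ρ guarded →
      _ , σ-value k (extend-value (has-value ρ l guarded)) ,
      subst (HasValue ρ (σ k t)) (sym (pres ρ guarded))
        (σ-value k (extend-value {x = head³ t} (t-value _ , t-value _ , t-value _)))

    base-value : ∀ l → HasValue³ base (member l) (value base l)
    base-value l = has-value base l (guard-base l)

  solution-correct : ∀ l → IsSolution (3 ℕ.+ m) i j (solution l)
  solution-correct l =
    (λ k den≈0 → den≢0 (extend-value (base-value l) k) (den≈0 base)) ,
    σ-solution i l (λ ρ → σᵢ ρ l) , σ-solution j l (λ ρ → σⱼ ρ l)

  solution-injective : ∀ l l′ → l ≢ l′ → ¬ (solution l ≈V solution l′)
  solution-injective l l′ l≢l′ eq with base-value l | base-value l′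
  ... | x , y , z | x′ , y′ , z′ = l≢l′ (injective (cong₂ _,_ (≈R⇒value≡ (eq zero) x x′)
    (cong₂ _,_ (≈R⇒value≡ (eq (suc zero)) y y′) (≈R⇒value≡ (eq (suc (suc zero))) z z′))))

-- The conic for i = 1, j = 2

-- The lines through (t₁, t₂, t₃) in the directions (1, l, -1 - l) meet the conic again.
module Conic where
  L D : ℕ → ℚ
  L l = fromℕ l
  D l = fromℕ (1 ℕ.+ l ℕ.+ l ℕ.* l)

  D≡ : ∀ l → D l ≡ 1ℚ + L l + L l * L l
  D≡ l = trans (fromℕ-+ (1 ℕ.+ l) (l ℕ.* l)) (cong₂ _+_ (fromℕ-+ 1 l) (fromℕ-* l l))

  D≢0 : ∀ l → D l ≢ 0ℚ
  D≢0 l ()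

  module _ {A : Set} (O : Operations A) (κ : ℚ → A) where
    open Operations O

    -- A move by `s` along the line changes the second symmetric function by - s (D s + linear) and
    -- fixes the first, the direction having sum 0; `slope` is the second zero.
    linear slope : ℕ → A × A × A → A
    linear l (x , y , z) = x ⊞ κ (L l) ⊠ y ⊟ κ (1ℚ + L l) ⊠ z
    slope l s = neg (linear l s) ⊠ κ (inv (D l))

    point : ℕ → A × A × A → A × A × A
    point l s@(x , y , z) = x ⊞ slope l s , y ⊞ κ (L l) ⊠ slope l s , z ⊟ κ (1ℚ + L l) ⊠ slope l s

-- Running a formula on such pairs yields the rational function, its value and the proof that they
-- match at once.
record Valued {n} (ρ : Fin n → ℚ) : Set where
  constructor valued
  field
    {fun}     : RatFun n
    {val}     : ℚ
    witnessed : HasValue ρ fun val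
open Valued

RatFun-operations : ∀ {n} → Operations (RatFun n)
RatFun-operations = operations _+R_ _*R_ negR invR

-- Inversion is not total here; formulas evaluated with these operations must not use it.
Valued-operations : ∀ {n} {ρ : Fin n → ℚ} → Operations (Valued ρ)
Valued-operations = operations
  (λ a b → valued (+R-value {f = fun a} {g = fun b} (witnessed a) (witnessed b)))
  (λ a b → valued (*R-value {f = fun a} {g = fun b} (witnessed a) (witnessed b)))
  (λ a → valued (negR-value {f = fun a} (witnessed a)))
  (λ a → a)

valued-t : ∀ {n} {ρ : Fin n → ℚ} → Fin n → Valued ρ
valued-t k = valued {fun = t k} (t-value k)

conic-family : ∀ m → Family m 1 2
conic-family m = record
  { member    = λ l → point RatFun-operations const l (head³ t)
  ; value     = λ ρ l → point ℚ-operations (λ c → c) l (head³ ρ)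
  -- Only the nonzero constants `D l` are inverted, so no point has to be excluded.
  ; guard     = λ _ → con 1ℚ
  ; has-value = λ ρ l _ →
      let x , y , z = point (Valued-operations {ρ = ρ}) (λ c → valued (con-value c)) l
                        (valued-t zero , valued-t (suc zero) , valued-t (suc (suc zero)))
      in witnessed x , witnessed y , witnessed z
  ; σᵢ        = λ ρ l _ → σ₁ l (ρ zero) (ρ (suc zero)) (ρ (suc (suc zero))) (tail³ ρ)
  ; σⱼ        = λ ρ l _ → σ₂ l (ρ zero) (ρ (suc zero)) (ρ (suc (suc zero))) (tail³ ρ)
  ; base      = extend (1ℚ , 0ℚ , 0ℚ) (λ _ → 0ℚ)
  ; guard-base = λ _ ()
  ; injective = injective
  }
  where
  open Conic

  module _ (l : ℕ) (x y z : ℚ) where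
    s = slope ℚ-operations (λ c → c) l (x , y , z)

    Ds : (1ℚ + L l + L l * L l) * s ≡ - (x + L l * y - (1ℚ + L l) * z)
    Ds = trans (cong (_* s) (sym (D≡ l))) (x*[y*inv-x]≡y _ (D≢0 l))

    module _ {m} (r : Fin m → ℚ) where
      σ₁ : esym 1 (extend (point ℚ-operations (λ c → c) l (x , y , z)) r) ≡ esym 1 (extend (x , y , z) r)
      σ₁ = solve 6 (λ L s x y z e → e :+ (z :- (𝟙 :+ L) :* s) :* 𝟙 :+ (y :+ L :* s) :* 𝟙 :+ (x :+ s) :* 𝟙
        := e :+ z :* 𝟙 :+ y :* 𝟙 :+ x :* 𝟙) refl (L l) s x y z (esym 1 r)

      σ₂ : esym 2 (extend (point ℚ-operations (λ c → c) l (x , y , z)) r) ≡ esym 2 (extend (x , y , z) r)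
      σ₂ = x-y≡0⇒x≡y (begin
        esym 2 (extend (point ℚ-operations (λ c → c) l (x , y , z)) r) - esym 2 (extend (x , y , z) r)
          ≡⟨ solve 7 (λ L s x y z e₂ e₁ →
               let e : _ → _ → _ → _
                   e x y z = e₂ :+ z :* e₁ :+ y :* (e₁ :+ z :* 𝟙) :+ x :* (e₁ :+ z :* 𝟙 :+ y :* 𝟙) in
               e (x :+ s) (y :+ L :* s) (z :- (𝟙 :+ L) :* s) :- e x y z :=
               :- s :* ((𝟙 :+ L :+ L :* L) :* s :- :- (x :+ L :* y :- (𝟙 :+ L) :* z)))
               refl (L l) s x y z (esym 2 r) (esym 1 r) ⟩
        - s * ((1ℚ + L l + L l * L l) * s - - (x + L l * y - (1ℚ + L l) * z))
          ≡⟨ cong (- s *_) (x≡y⇒x-y≡0 Ds) ⟩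
        - s * 0ℚ ≡⟨ zeroʳ _ ⟩
        0ℚ ∎)

  -- From (1, 0, 0) the first two coordinates become 1 + s and l s, and `s` is nonzero because D s =
  -- -1; so `l` can be read off.
  injective : ∀ {l l′} → point ℚ-operations (λ c → c) l (1ℚ , 0ℚ , 0ℚ) ≡ point ℚ-operations (λ c → c) l′ (1ℚ , 0ℚ , 0ℚ) → l ≡ l′
  injective {l} {l′} eq = fromℕ-injective (*-cancelˡ s≢0 (begin
    s₀ * L l        ≡⟨ solve 2 (λ s L → s :* L := 𝟘 :+ L :* s) refl s₀ (L l) ⟩
    0ℚ + L l * s₀   ≡⟨ cong (proj₁ ∘ proj₂) eq ⟩
    0ℚ + L l′ * s₀′ ≡⟨ cong (λ s → 0ℚ + L l′ * s) s≡s′ ⟨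
    0ℚ + L l′ * s₀  ≡⟨ solve 2 (λ s L → 𝟘 :+ L :* s := s :* L) refl s₀ (L l′) ⟩
    s₀ * L l′       ∎))
    where
    s₀ = s l 1ℚ 0ℚ 0ℚ
    s₀′ = s l′ 1ℚ 0ℚ 0ℚ

    s≡s′ : s₀ ≡ s₀′
    s≡s′ = begin
      s₀              ≡⟨ solve 1 (λ s → s := 𝟙 :+ s :- 𝟙) refl s₀ ⟩
      1ℚ + s₀ - 1ℚ    ≡⟨ cong (λ p → proj₁ p - 1ℚ) eq ⟩
      1ℚ + s₀′ - 1ℚ   ≡⟨ solve 1 (λ s → 𝟙 :+ s :- 𝟙 := s) refl s₀′ ⟩
      s₀′             ∎

    s≢0 : s₀ ≢ 0ℚ
    s≢0 s≡0 = 1≢0 (begin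
      1ℚ ≡⟨ solve 1 (λ L → 𝟙 := :- (:- (𝟙 :+ L :* 𝟘 :- (𝟙 :+ L) :* 𝟘))) refl (L l) ⟩
      - (- (1ℚ + L l * 0ℚ - (1ℚ + L l) * 0ℚ)) ≡⟨ cong -_ (Ds l 1ℚ 0ℚ 0ℚ) ⟨
      - ((1ℚ + L l + L l * L l) * s₀) ≡⟨ cong (λ s → - ((1ℚ + L l + L l * L l) * s)) s≡0 ⟩
      - ((1ℚ + L l + L l * L l) * 0ℚ) ≡⟨ solve 1 (λ D → :- (D :* 𝟘) := 𝟘) refl _ ⟩
      0ℚ ∎)
      where
      1≢0 : 1ℚ ≢ 0ℚ
      1≢0 ()

-- Orbits

module Orbit {A : Set} (O : Operations A) (d₁ d₂ d₃ : A) where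
  next : A × A × A → A × A × A
  -- This order keeps the orbit of the base point in the form (0, u, v): there `z′` is 0, `y′` is
  -- the new `u` and `x′` the new `v`.
  next (x , y , z) = z′ , y′ , x′
    where open Formulas.Step O d₁ d₂ d₃ x y z

  orbit : A × A × A → ℕ → A × A × A
  orbit s zero    = s
  orbit s (suc l) = next (orbit s l)

module StepGuard {n} (d₁ d₂ d₃ x y z : RatFun n) where
  open Operations (RatFun-operations {n})
  open Formulas.Step RatFun-operations d₁ d₂ d₃ x y z

  poleR gR separationR : RatFun n
  poleR = c ⊠ x′ ⊞ d
  gR = g x′
  separationR = x′ ⊟ y′

  -- Numerators suffice: at a point where a rational function has a value, that value is nonzero
  -- exactly when the numerator is.
  guardR : Poly n
  guardR = num ℓ₁ ⊗ (num poleR ⊗ (num gR ⊗ num separationR))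

module StepValue {n} {ρ : Fin n → ℚ} (d₁ d₂ d₃ x y z : Valued ρ) where
  private
    module V = Formulas.Step Valued-operations d₁ d₂ d₃ x y z
    module R = Formulas.Step RatFun-operations (fun d₁) (fun d₂) (fun d₃) (fun x) (fun y) (fun z)
    module Q = Formulas.Step ℚ-operations (val d₁) (val d₂) (val d₃) (val x) (val y) (val z)
    open Operations (Valued-operations {ρ = ρ})
    open StepProperties (val d₁) (val d₂) (val d₃) (val x) (val y) (val z)

  open StepGuard (fun d₁) (fun d₂) (fun d₃) (fun x) (fun y) (fun z)

  -- The inverses are introduced one at a time, as each needs a nonzero value; the ring operations
  -- between them are those of `Valued-operations`.
  module _ (ℓ₁≢0 : Q.ℓ₁ ≢ 0ℚ) where
    x′-valued : Valued ρ
    x′-valued = valued {fun = R.x′} {val = Q.x′}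
      (*R-value {f = R.ℓ₀} {g = invR R.ℓ₁} (witnessed V.ℓ₀) (invR-value {f = R.ℓ₁} (witnessed V.ℓ₁) ℓ₁≢0))

    private
      pole = V.c ⊠ x′-valued ⊞ V.d

    pole-value : HasValue ρ poleR (Q.c * Q.x′ + Q.d)
    pole-value = witnessed pole

    g-value : HasValue ρ gR (Q.g Q.x′)
    g-value = witnessed (V.g x′-valued)

    module _ (pole≢0 : Q.c * Q.x′ + Q.d ≢ 0ℚ) where
      y′-valued : Valued ρ
      y′-valued = valued {fun = R.y′} {val = Q.y′}
        (*R-value {f = fun e} {g = invR poleR} (witnessed e) (invR-value {f = poleR} pole-value pole≢0))
        where e = V.a ⊠ x′-valued ⊞ V.b

      separation-value : HasValue ρ separationR (Q.x′ - Q.y′)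
      separation-value = witnessed (x′-valued ⊟ y′-valued)

      module _ (g≢0 : Q.g Q.x′ ≢ 0ℚ) where
        z′-valued : Valued ρ
        z′-valued = x ⊞ y ⊞ z ⊞ slope ⊠ d₁ ⊟ x′-valued ⊟ y′-valued
          where
          slope : Valued ρ
          slope = valued {fun = R.slope} {val = Q.slope}
            (*R-value {f = fun (neg (V.h x′-valued))} {g = invR gR} (witnessed (neg (V.h x′-valued)))
              (invR-value {f = gR} g-value g≢0))

  next-value : Regular → HasValue³ ρ
    (Orbit.next RatFun-operations (fun d₁) (fun d₂) (fun d₃) (fun x , fun y , fun z))
    (Orbit.next ℚ-operations (val d₁) (val d₂) (val d₃) (val x , val y , val z))
  next-value (regular ℓ₁≢0 pole≢0 g≢0 _) =
    witnessed (z′-valued ℓ₁≢0 pole≢0 g≢0) , witnessed (y′-valued ℓ₁≢0 pole≢0) , witnessed (x′-valued ℓ₁≢0)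

  guard⇒regular : eval guardR ρ ≢ 0ℚ → Regular
  guard⇒regular nz =
    let ℓ₁-nz , nz₁ = eval-⊗-≢0⁻¹ (num R.ℓ₁) (num poleR ⊗ (num gR ⊗ num separationR)) ρ nz
        pole-nz , nz₂ = eval-⊗-≢0⁻¹ (num poleR) (num gR ⊗ num separationR) ρ nz₁
        g-nz , sep-nz = eval-⊗-≢0⁻¹ (num gR) (num separationR) ρ nz₂
        ℓ₁≢0 = num≢0⇒value≢0 {f = R.ℓ₁} (witnessed V.ℓ₁) ℓ₁-nz
        pole≢0 = num≢0⇒value≢0 {f = poleR} (pole-value ℓ₁≢0) pole-nz
    in regular ℓ₁≢0 pole≢0 (num≢0⇒value≢0 {f = gR} (g-value ℓ₁≢0) g-nz)
         (num≢0⇒value≢0 {f = separationR} (separation-value ℓ₁≢0 pole≢0) sep-nz)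

  regular⇒guard : Regular → eval guardR ρ ≢ 0ℚ
  regular⇒guard (regular ℓ₁≢0 pole≢0 g≢0 sep≢0) =
    eval-⊗-≢0 (num R.ℓ₁) (num poleR ⊗ (num gR ⊗ num separationR)) ρ
      (value≢0⇒num≢0 {f = R.ℓ₁} (witnessed V.ℓ₁) ℓ₁≢0)
      (eval-⊗-≢0 (num poleR) (num gR ⊗ num separationR) ρ
        (value≢0⇒num≢0 {f = poleR} (pole-value ℓ₁≢0) pole≢0)
        (eval-⊗-≢0 (num gR) (num separationR) ρ
          (value≢0⇒num≢0 {f = gR} (g-value ℓ₁≢0) g≢0)
          (value≢0⇒num≢0 {f = separationR} (separation-value ℓ₁≢0 pole≢0) sep≢0)))

-- The direction of the pencil and the generic orbit

module Cross {A : Set} (O : Operations A) (α β : A × A × A) where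
  open Operations O
  private
    α₁ = proj₁ α
    α₂ = proj₁ (proj₂ α)
    α₃ = proj₂ (proj₂ α)
    β₁ = proj₁ β
    β₂ = proj₁ (proj₂ β)
    β₃ = proj₂ (proj₂ β)

  -- The cross product of `α` and `β` is orthogonal to both, so a move along it preserves both
  -- linear equations.
  d₁ d₂ d₃ : A
  d₁ = α₂ ⊠ β₃ ⊟ α₃ ⊠ β₂
  d₂ = α₃ ⊠ β₁ ⊟ α₁ ⊠ β₃
  d₃ = α₁ ⊠ β₂ ⊟ α₂ ⊠ β₁

-- The coefficients of the three symmetric functions in `esym-extend`.
coefficients : {A : Set} → A → (ℕ → A) → ℕ → A × A × A
coefficients z f k = shift z f k , shift z (shift z f) k , shift z (shift z (shift z f)) k

shift-value : ∀ {n} {ρ : Fin n → ℚ} {f v} → (∀ k → HasValue ρ (f k) (v k)) →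
  ∀ k → HasValue ρ (shift 0R f k) (shift 0ℚ v k)
shift-value f-v zero    = 0R-value
shift-value f-v (suc k) = f-v k

pairing : ℚ × ℚ × ℚ → ℚ × ℚ × ℚ → ℚ
pairing (α₁ , α₂ , α₃) (x , y , z) =
  α₁ * (x + y + z) + α₂ * (x * y + x * z + y * z) + α₃ * (x * y * z)

-- The step moves the symmetric functions by `slope` times the direction, to which the coefficient
-- vector is orthogonal.
next-pairing : ∀ α₁ α₂ α₃ d₁ d₂ d₃ x y z → α₁ * d₁ + α₂ * d₂ + α₃ * d₃ ≡ 0ℚ →
  StepProperties.Regular d₁ d₂ d₃ x y z →
  pairing (α₁ , α₂ , α₃) (Orbit.next ℚ-operations d₁ d₂ d₃ (x , y , z)) ≡ pairing (α₁ , α₂ , α₃) (x , y , z)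
next-pairing α₁ α₂ α₃ d₁ d₂ d₃ x y z α·d≡0 ok = begin
  pairing (α₁ , α₂ , α₃) (z′ , y′ , x′)
    ≡⟨ solve 6 (λ α₁ α₂ α₃ x y z →
         α₁ :* (z :+ y :+ x) :+ α₂ :* (z :* y :+ z :* x :+ y :* x) :+ α₃ :* (z :* y :* x) :=
         α₁ :* (x :+ y :+ z) :+ α₂ :* (x :* y :+ x :* z :+ y :* z) :+ α₃ :* (x :* y :* z)) refl α₁ α₂ α₃ x′ y′ z′ ⟩
  α₁ * e₁ x′ y′ z′ + α₂ * e₂ x′ y′ z′ + α₃ * e₃ x′ y′ z′
    ≡⟨ cong₂ _+_ (cong₂ (λ a b → α₁ * a + α₂ * b) (step-e₁ ok) (step-e₂ ok)) (cong (α₃ *_) (step-e₃ ok)) ⟩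
  α₁ * (e₁ x y z + slope * d₁) + α₂ * (e₂ x y z + slope * d₂) + α₃ * (e₃ x y z + slope * d₃)
    ≡⟨ solve 10 (λ α₁ α₂ α₃ d₁ d₂ d₃ a b c s →
         α₁ :* (a :+ s :* d₁) :+ α₂ :* (b :+ s :* d₂) :+ α₃ :* (c :+ s :* d₃) :=
         α₁ :* a :+ α₂ :* b :+ α₃ :* c :+ s :* (α₁ :* d₁ :+ α₂ :* d₂ :+ α₃ :* d₃))
         refl α₁ α₂ α₃ d₁ d₂ d₃ (e₁ x y z) (e₂ x y z) (e₃ x y z) slope ⟩
  pairing (α₁ , α₂ , α₃) (x , y , z) + slope * (α₁ * d₁ + α₂ * d₂ + α₃ * d₃)
    ≡⟨ cong (λ p → pairing (α₁ , α₂ , α₃) (x , y , z) + slope * p) α·d≡0 ⟩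
  pairing (α₁ , α₂ , α₃) (x , y , z) + slope * 0ℚ
    ≡⟨ solve 2 (λ x s → x :+ s :* 𝟘 := x) refl _ slope ⟩
  pairing (α₁ , α₂ , α₃) (x , y , z) ∎
  where
  open Formulas.Step ℚ-operations d₁ d₂ d₃ x y z
  open StepProperties d₁ d₂ d₃ x y z

module Generic (m i j : ℕ) where
  private
    n = 3 ℕ.+ m

  αR βR : RatFun n × RatFun n × RatFun n
  αR = coefficients 0R (λ k → σ k (tail³ {m = m} t)) i
  βR = coefficients 0R (λ k → σ k (tail³ {m = m} t)) j

  module R = Cross RatFun-operations αR βR
  module RO = Orbit RatFun-operations R.d₁ R.d₂ R.d₃

  member : ℕ → RatFun n × RatFun n × RatFun n
  member = RO.orbit (head³ t)

  stepGuard : RatFun n × RatFun n × RatFun n → Poly n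
  stepGuard (x , y , z) = StepGuard.guardR R.d₁ R.d₂ R.d₃ x y z

  guard : ℕ → Poly n
  guard zero    = con 1ℚ
  guard (suc l) = guard l ⊗ stepGuard (member l)

  module At (ρ : Fin n → ℚ) where
    α β : ℚ × ℚ × ℚ
    α = coefficients 0ℚ (λ k → esym k (tail³ ρ)) i
    β = coefficients 0ℚ (λ k → esym k (tail³ ρ)) j

    open Cross ℚ-operations α β public
    open Orbit ℚ-operations d₁ d₂ d₃ public

    value : ℕ → ℚ × ℚ × ℚ
    value = orbit (head³ ρ)

    private
      tail-value : ∀ k → HasValue ρ (σ k (tail³ {m = m} t)) (esym k (tail³ ρ))
      tail-value k = σ-value k (λ _ → t-value _)

      coefficientsV : ℕ → Valued ρ × Valued ρ × Valued ρ
      coefficientsV k = valued (shift-value tail-value k) , valued (shift-value (shift-value tail-value) k) ,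
        valued (shift-value (shift-value (shift-value tail-value)) k)

      module V = Cross Valued-operations (coefficientsV i) (coefficientsV j)

      module NextValue {x y z u v w} (f-v : HasValue³ ρ (x , y , z) (u , v , w)) =
        StepValue V.d₁ V.d₂ V.d₃ (valued {fun = x} {val = u} (proj₁ f-v))
          (valued {fun = y} {val = v} (proj₁ (proj₂ f-v))) (valued {fun = z} {val = w} (proj₂ (proj₂ f-v)))

    RegularAt : ℚ × ℚ × ℚ → Set
    RegularAt (x , y , z) = StepProperties.Regular d₁ d₂ d₃ x y z

    -- Mutual recursion: regularity of a step can be read off its guard only once the current member
    -- has a value, and the value of the next member needs that regularity.
    has-value : ∀ l → eval (guard l) ρ ≢ 0ℚ → HasValue³ ρ (member l) (value l)
    guard⇒regularAt : ∀ l → eval (guard (suc l)) ρ ≢ 0ℚ → eval (guard l) ρ ≢ 0ℚ × RegularAt (value l)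

    has-value zero    _       = t-value _ , t-value _ , t-value _
    has-value (suc l) guarded =
      let guardedₗ , ok = guard⇒regularAt l guarded
      in NextValue.next-value (has-value l guardedₗ) ok

    guard⇒regularAt l guarded =
      let guardedₗ , step-guarded = eval-⊗-≢0⁻¹ (guard l) (stepGuard (member l)) ρ guarded
      in guardedₗ , NextValue.guard⇒regular (has-value l guardedₗ) step-guarded

    regularAt⇒guard : (∀ l → RegularAt (value l)) → ∀ l → eval (guard l) ρ ≢ 0ℚ
    regularAt⇒guard ok zero    ()
    regularAt⇒guard ok (suc l) = eval-⊗-≢0 (guard l) (stepGuard (member l)) ρ guardedₗ
      (NextValue.regular⇒guard (has-value l guardedₗ) (ok l))
      where guardedₗ = regularAt⇒guard ok l

    private
      preserved : ∀ k →
        (let α₁ , α₂ , α₃ = coefficients 0ℚ (λ k → esym k (tail³ ρ)) k in α₁ * d₁ + α₂ * d₂ + α₃ * d₃ ≡ 0ℚ) →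
        ∀ l → eval (guard l) ρ ≢ 0ℚ → σ-preserved k ρ (value l)
      preserved k α·d≡0 l guarded = begin
        esym k (extend (value l) (tail³ ρ))      ≡⟨ esym-extend _ _ _ (tail³ ρ) k ⟩
        esym k (tail³ ρ) + pairing γ (value l)   ≡⟨ cong (esym k (tail³ ρ) +_) (constant l guarded) ⟩
        esym k (tail³ ρ) + pairing γ (head³ ρ)   ≡⟨ esym-extend _ _ _ (tail³ ρ) k ⟨
        esym k (extend (head³ ρ) (tail³ ρ))      ∎
        where
        γ = coefficients 0ℚ (λ k → esym k (tail³ ρ)) k

        constant : ∀ l → eval (guard l) ρ ≢ 0ℚ → pairing γ (value l) ≡ pairing γ (head³ ρ)
        constant zero    _       = refl
        constant (suc l) guarded =
          let guardedₗ , ok = guard⇒regularAt l guarded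
          in trans (next-pairing _ _ _ d₁ d₂ d₃ _ _ _ α·d≡0 ok) (constant l guardedₗ)

    σᵢ : ∀ l → eval (guard l) ρ ≢ 0ℚ → σ-preserved i ρ (value l)
    σᵢ = preserved i (solve 6 (λ α₁ α₂ α₃ β₁ β₂ β₃ →
      α₁ :* (α₂ :* β₃ :- α₃ :* β₂) :+ α₂ :* (α₃ :* β₁ :- α₁ :* β₃) :+ α₃ :* (α₁ :* β₂ :- α₂ :* β₁) := 𝟘)
      refl (proj₁ α) (proj₁ (proj₂ α)) (proj₂ (proj₂ α)) (proj₁ β) (proj₁ (proj₂ β)) (proj₂ (proj₂ β)))

    σⱼ : ∀ l → eval (guard l) ρ ≢ 0ℚ → σ-preserved j ρ (value l)
    σⱼ = preserved j (solve 6 (λ α₁ α₂ α₃ β₁ β₂ β₃ →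
      β₁ :* (α₂ :* β₃ :- α₃ :* β₂) :+ β₂ :* (α₃ :* β₁ :- α₁ :* β₃) :+ β₃ :* (α₁ :* β₂ :- α₂ :* β₁) := 𝟘)
      refl (proj₁ α) (proj₁ (proj₂ α)) (proj₂ (proj₂ α)) (proj₁ β) (proj₁ (proj₂ β)) (proj₂ (proj₂ β)))

-- The base point

nC0≡1 : ∀ n → n choose 0 ≡ 1
nC0≡1 n = trans (nCk≡nC[n∸k] {0} {n} z≤n) (nCn≡1 n)

nCk≢0 : ∀ {n k} → k ≤ n → n choose k ≢ 0
nCk≢0 {n}     {zero}  z≤n       eq with () ← trans (sym (nC0≡1 n)) eq
nCk≢0 {suc n} {suc k} (s≤s k≤n) eq =
  nCk≢0 k≤n (ℕ.m+n≡0⇒m≡0 (n choose k) (trans (nCk+nC[k+1]≡[n+1]C[k+1] n k) eq))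

ones : (j : ℕ) {m : ℕ} → Fin m → ℚ
ones zero    _       = 0ℚ
ones (suc j) zero    = 1ℚ
ones (suc j) (suc k) = ones j k

-- Pascal's rule is the recursion of `esym` with first entry 1.
esym-ones : (j : ℕ) {m : ℕ} (k : ℕ) → j ≤ m → esym k (ones j {m}) ≡ fromℕ (j choose k)
esym-ones j             zero    _         = sym (cong fromℕ (nC0≡1 j))
esym-ones zero {zero}   (suc k) _         = sym (cong fromℕ (k>n⇒nCk≡0 {0} {suc k} (s≤s z≤n)))
esym-ones zero {suc m}  (suc k) _         = begin
  esym (suc k) (ones 0 {m}) + 0ℚ * esym k (ones 0 {m}) ≡⟨ solve 2 (λ x y → x :+ 𝟘 :* y := x) refl
                                                               (esym (suc k) (ones 0 {m})) (esym k (ones 0 {m})) ⟩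
  esym (suc k) (ones 0 {m})                            ≡⟨ esym-ones 0 {m} (suc k) z≤n ⟩
  fromℕ (0 choose suc k)                               ∎
esym-ones (suc j) {suc m} (suc k) (s≤s j≤m) = begin
  esym (suc k) (ones j {m}) + 1ℚ * esym k (ones j {m}) ≡⟨ solve 2 (λ x y → x :+ 𝟙 :* y := y :+ x) refl
                                                               (esym (suc k) (ones j {m})) (esym k (ones j {m})) ⟩
  esym k (ones j {m}) + esym (suc k) (ones j {m})      ≡⟨ cong₂ _+_ (esym-ones j k j≤m) (esym-ones j (suc k) j≤m) ⟩
  fromℕ (j choose k) + fromℕ (j choose suc k)          ≡⟨ fromℕ-+ (j choose k) (j choose suc k) ⟨
  fromℕ (j choose k ℕ.+ j choose suc k)                ≡⟨ cong fromℕ (nCk+nC[k+1]≡[n+1]C[k+1] j k) ⟩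
  fromℕ (suc j choose suc k)                           ∎

-- These are the numbers 2^(3^l), the parameters `W` of the base orbit. The start 2 avoids 0, 1 and
-- -1, where the nondegeneracy conditions fail.
tower : ℕ → ℕ
tower zero    = 2
tower (suc l) = tower l ℕ.* tower l ℕ.* tower l

2≤tower : ∀ l → 2 ≤ tower l
2≤tower zero    = ℕ.≤-refl
2≤tower (suc l) = ℕ.≤-trans (s≤s (s≤s z≤n)) (ℕ.*-mono-≤ (ℕ.*-mono-≤ (2≤tower l) (2≤tower l)) (2≤tower l))

tower-increasing : ∀ l → tower l < tower (suc l)
tower-increasing l = ℕ.<-≤-trans (ℕ.m<m*n (tower l) (tower l) {{ℕ.>-nonZero (ℕ.<⇒≤ (2≤tower l))}} (2≤tower l))
  (ℕ.m≤m*n (tower l ℕ.* tower l) (tower l) {{ℕ.>-nonZero (ℕ.<⇒≤ (2≤tower l))}})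

tower-mono-< : ∀ {k l} → k < l → tower k < tower l
tower-mono-< {k} {suc l} (s≤s k≤l) with ℕ.m≤n⇒m<n∨m≡n k≤l
... | inj₁ k<l  = ℕ.<-trans (tower-mono-< k<l) (tower-increasing l)
... | inj₂ refl = tower-increasing l

tower-injective : ∀ {k l} → tower k ≡ tower l → k ≡ l
tower-injective {k} {l} eq with ℕ.<-cmp k l
... | tri< k<l _ _ = contradiction eq (ℕ.<⇒≢ (tower-mono-< k<l))
... | tri≈ _ k≡l _ = k≡l
... | tri> _ _ l<k = contradiction (sym eq) (ℕ.<⇒≢ (tower-mono-< l<k))

fromℕ-≢0 : ∀ {n} → n ≢ 0 → fromℕ n ≢ 0ℚ
fromℕ-≢0 n≢0 = n≢0 ∘ fromℕ-injective

next-cong : ∀ {a b c a′ b′ c′ s s′} → a ≡ a′ → b ≡ b′ → c ≡ c′ → s ≡ s′ →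
  Orbit.next ℚ-operations a b c s ≡ Orbit.next ℚ-operations a′ b′ c′ s′
next-cong refl refl refl refl = refl

-- With t₄, …, tⱼ equal to 1 and the later tₖ equal to 0, the direction is (p, -q, 0).
module BasePoint (m i j : ℕ) (i≤1+j : i ≤ suc j) (j≤m : j ≤ m) where
  -- The indices of the two equations are `suc i` and `3 + j`; at the base point `q` and `p` are the
  -- coefficients of the first and second symmetric functions in the former.
  p q : ℕ
  p = shift 0 (j choose_) i
  q = j choose i

  -- By Pascal's rule the sum is `suc j choose i`, which is nonzero for `i ≤ suc j`.
  k≢0ᴺ : p ℕ.+ q ≢ 0
  k≢0ᴺ = k≢0′ i i≤1+j
    where
    k≢0′ : ∀ i → i ≤ suc j → shift 0 (j choose_) i ℕ.+ j choose i ≢ 0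
    k≢0′ zero    _         = nCk≢0 {j} z≤n
    k≢0′ (suc i) (s≤s i≤j) = nCk≢0 i≤j ∘ ℕ.m+n≡0⇒m≡0 (j choose i)

  open Degenerate (fromℕ p) (fromℕ q)

  k-fromℕ : fromℕ (p ℕ.+ q) ≡ k
  k-fromℕ = fromℕ-+ p q

  k≢0 : k ≢ 0ℚ
  k≢0 = subst (_≢ 0ℚ) k-fromℕ (fromℕ-≢0 k≢0ᴺ)

  C≢0 : C ≢ 0ℚ
  C≢0 = subst (_≢ 0ℚ) (trans (fromℕ-+ (q ℕ.+ q) p) (cong (_+ fromℕ p) (fromℕ-+ q q)))
    (fromℕ-≢0 λ eq → k≢0ᴺ (trans (ℕ.+-comm p q)
      (cong₂ ℕ._+_ (ℕ.m+n≡0⇒m≡0 q (ℕ.m+n≡0⇒m≡0 (q ℕ.+ q) eq)) (ℕ.m+n≡0⇒n≡0 (q ℕ.+ q) eq))))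

  module _ (w : ℕ) where
    A≢0 : A (fromℕ w) ≢ 0ℚ
    A≢0 = subst (_≢ 0ℚ) (trans (fromℕ-+ (q ℕ.* w) (p ℕ.+ q)) (cong₂ _+_ (fromℕ-* q w) k-fromℕ))
      (fromℕ-≢0 (k≢0ᴺ ∘ ℕ.m+n≡0⇒n≡0 (q ℕ.* w)))

    B≢0 : w ≢ 0 → B (fromℕ w) ≢ 0ℚ
    B≢0 w≢0 = subst (_≢ 0ℚ)
      (trans (fromℕ-+ q ((p ℕ.+ q) ℕ.* w)) (cong (fromℕ q +_) (trans (fromℕ-* (p ℕ.+ q) w) (cong (_* fromℕ w) k-fromℕ))))
      (fromℕ-≢0 λ eq → [ k≢0ᴺ , w≢0 ]′ (ℕ.m*n≡0⇒m≡0∨n≡0 (p ℕ.+ q) (ℕ.m+n≡0⇒n≡0 q eq)))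

    W²≢1 : 2 ≤ w → fromℕ w * fromℕ w - 1ℚ ≢ 0ℚ
    W²≢1 2≤w eq = ℕ.<⇒≢ (ℕ.≤-trans (s≤s (s≤s z≤n)) (ℕ.*-mono-≤ 2≤w 2≤w))
      (sym (fromℕ-injective (trans (fromℕ-* w w) (x-y≡0⇒x≡y eq))))

  W : ℕ → ℚ
  W l = fromℕ (tower l)

  W-suc : ∀ l → W (suc l) ≡ W l * W l * W l
  W-suc l = trans (fromℕ-* (tower l ℕ.* tower l) (tower l)) (cong (_* W l) (fromℕ-* (tower l) (tower l)))

  tower≢0 : ∀ l → tower l ≢ 0
  tower≢0 l eq = contradiction (subst (2 ≤_) eq (2≤tower l)) λ ()

  state : ℕ → ℚ × ℚ × ℚ
  state l = 0ℚ , u (W l) , v (W l)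

  nondegenerate-W : ∀ l → Nondegenerate (W l)
  nondegenerate-W l = nondegenerate k≢0 C≢0 (fromℕ-≢0 (tower≢0 l)) (A≢0 _) (B≢0 _ (tower≢0 l))

  module _ (l : ℕ) where
    private
      ok³ : Nondegenerate (W l * W l * W l)
      ok³ = subst Nondegenerate (W-suc l) (nondegenerate-W (suc l))

      W⁶≢1 : W l * W l * W l * (W l * W l * W l) - 1ℚ ≢ 0ℚ
      W⁶≢1 = subst (λ W → W * W - 1ℚ ≢ 0ℚ) (W-suc l) (W²≢1 _ (2≤tower (suc l)))

    state-regular : StepProperties.Regular (fromℕ p) (- fromℕ q) 0ℚ 0ℚ (u (W l)) (v (W l))
    state-regular = step-regular (nondegenerate-W l) ok³ (W²≢1 _ (2≤tower l)) W⁶≢1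

    -- The components of state l are spelled out because comparing up to unfolding state is very slow.
    state-next : Orbit.next ℚ-operations (fromℕ p) (- fromℕ q) 0ℚ (0ℚ , u (W l) , v (W l)) ≡ state (suc l)
    state-next = trans
      (cong₂ _,_ (z′-val ok ok³ W²≢1ₗ W⁶≢1) (cong₂ _,_ (y′-val ok ok³ W²≢1ₗ W⁶≢1) (x′-val ok ok³ W²≢1ₗ W⁶≢1)))
      (cong (λ W → 0ℚ , u W , v W) (sym (W-suc l)))
      where
      ok = nondegenerate-W l
      W²≢1ₗ = W²≢1 _ (2≤tower l)

  -- `v W` determines `B W` as `C / v W`, and `B` is linear in `W` with leading coefficient `k ≢ 0`.
  state-injective : ∀ {l l′} → state l ≡ state l′ → l ≡ l′
  state-injective {l} {l′} eq = tower-injective (fromℕ-injective (*-cancelˡ k≢0 (begin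
    k * W l                         ≡⟨ solve 2 (λ x q → x := q :+ x :- q) refl _ (fromℕ q) ⟩
    B (W l) - fromℕ q               ≡⟨ cong (_- fromℕ q) (*-cancelˡ (v≢0 (nondegenerate-W l)) (begin
      v (W l) * B (W l)             ≡⟨ *-comm _ _ ⟩
      B (W l) * v (W l)             ≡⟨ Bv (nondegenerate-W l) ⟩
      C                             ≡⟨ Bv (nondegenerate-W l′) ⟨
      B (W l′) * v (W l′)           ≡⟨ cong (λ s → B (W l′) * proj₂ (proj₂ s)) eq ⟨
      B (W l′) * v (W l)            ≡⟨ *-comm _ _ ⟩
      v (W l) * B (W l′)            ∎)) ⟩
    B (W l′) - fromℕ q              ≡⟨ solve 2 (λ x q → q :+ x :- q := x) refl _ (fromℕ q) ⟩
    k * W l′                        ∎)))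

  base : Fin (3 ℕ.+ m) → ℚ
  base = extend (state 0) (ones j)

  open Generic m (suc i) (3 ℕ.+ j)
  open At base using (d₁; d₂; d₃; value; RegularAt; regularAt⇒guard)

  private
    S : ℕ → ℚ
    S k = esym k (ones j {m})

    α₁≡ : S i ≡ fromℕ q
    α₁≡ = esym-ones j i j≤m

    α₂≡ : shift 0ℚ S i ≡ fromℕ p
    α₂≡ = α₂≡′ i
      where
      α₂≡′ : ∀ i → shift 0ℚ S i ≡ fromℕ (shift 0 (j choose_) i)
      α₂≡′ zero    = refl
      α₂≡′ (suc i) = esym-ones j i j≤m

    -- Only `j` of the remaining parameters are nonzero, so at the base point the second equation
    -- has coefficients (0, 0, 1): it fixes the product of the three unknowns.
    β₁≡ : S (2 ℕ.+ j) ≡ 0ℚ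
    β₁≡ = trans (esym-ones j (2 ℕ.+ j) j≤m) (cong fromℕ (k>n⇒nCk≡0 {j} {2 ℕ.+ j} (s≤s (ℕ.n≤1+n j))))

    β₂≡ : S (1 ℕ.+ j) ≡ 0ℚ
    β₂≡ = trans (esym-ones j (1 ℕ.+ j) j≤m) (cong fromℕ (k>n⇒nCk≡0 {j} {suc j} ℕ.≤-refl))

    β₃≡ : S j ≡ 1ℚ
    β₃≡ = trans (esym-ones j j j≤m) (cong fromℕ (nCn≡1 j))

    α₃ = shift 0ℚ (shift 0ℚ S) i

    d₁≡ : d₁ ≡ fromℕ p
    d₁≡ = trans (cong₂ _-_ (cong₂ _*_ α₂≡ β₃≡) (cong (α₃ *_) β₂≡))
      (solve 2 (λ p x → p :* 𝟙 :- x :* 𝟘 := p) refl _ α₃)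

    d₂≡ : d₂ ≡ - fromℕ q
    d₂≡ = trans (cong₂ _-_ (cong (α₃ *_) β₁≡) (cong₂ _*_ α₁≡ β₃≡))
      (solve 2 (λ q x → x :* 𝟘 :- q :* 𝟙 := :- q) refl _ α₃)

    d₃≡ : d₃ ≡ 0ℚ
    d₃≡ = trans (cong₂ _-_ (cong (S i *_) β₂≡) (cong (shift 0ℚ S i *_) β₁≡))
      (solve 2 (λ x y → x :* 𝟘 :- y :* 𝟘 := 𝟘) refl (S i) (shift 0ℚ S i))

    value≡state : ∀ l → value l ≡ state l
    value≡state zero    = refl
    value≡state (suc l) = trans
      (next-cong d₁≡ d₂≡ d₃≡ (value≡state l))
      (state-next l)

    value-regular : ∀ l → RegularAt (value l)
    value-regular l = subst RegularAt (sym (value≡state l))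
      (transport (sym d₁≡) (sym d₂≡) (sym d₃≡) (state-regular l))
      where
      transport : ∀ {a b c a′ b′ c′ x y z} → a ≡ a′ → b ≡ b′ → c ≡ c′ →
        StepProperties.Regular a b c x y z → StepProperties.Regular a′ b′ c′ x y z
      transport refl refl refl ok = ok

  family : Family m (suc i) (3 ℕ.+ j)
  family = record
    { member     = member
    ; value      = λ ρ → At.value ρ
    ; guard      = guard
    ; has-value  = λ ρ → At.has-value ρ
    ; σᵢ         = λ ρ → At.σᵢ ρ
    ; σⱼ         = λ ρ → At.σⱼ ρ
    ; base       = base
    ; guard-base = regularAt⇒guard value-regular
    ; injective  = λ {l} {l′} eq → state-injective (trans (sym (value≡state l)) (trans eq (value≡state l′)))
    }

theorem3 : (n i j : ℕ) → 3 ≤ n → 1 ≤ i → i < j → j ≤ n →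
    Σ (ℕ → Fin n → RatFun n) λ f →
    (∀ m → IsSolution n i j (f m)) × (∀ m m′ → m ≢ m′ → ¬ (f m ≈V f m′))
theorem3 (suc (suc (suc m))) i j (s≤s (s≤s (s≤s z≤n))) 1≤i i<j j≤n =
  solution F , solution-correct F , solution-injective F
  where
  -- The orbit is used for third index at least 3, where `BasePoint` supplies a base point; below
  -- that the only admissible pair is (1, 2).
  family-for : ∀ {i j} → 1 ≤ i → i < j → j ≤ 3 ℕ.+ m → Family m i j
  family-for {suc _}       {suc zero}          _ (s≤s ()) _
  family-for {suc zero}    {suc (suc zero)}    _ _ _ = conic-family m
  family-for {suc (suc i)} {suc (suc zero)}    _ (s≤s (s≤s ())) _
  family-for {suc i}       {suc (suc (suc j))} _ (s≤s (s≤s i≤1+j)) (s≤s (s≤s (s≤s j≤m))) =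
    BasePoint.family m i j i≤1+j j≤m

  F = family-for 1≤i i<j j≤n
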